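{- Let $n$ be a positive integer and let $S=S_1\cup S_2\subseteq T_{8n}\setminus\{e\}$, where $S_1=(\langle a^2\rangle\setminus\{e\})\cup\langle a\rangle b^2$ and $S_2=\langle a\rangle b\cup\langle a\rangle b^3$ (so that $S=S^{ -1}$). Then $\mathrm{Cay}(T_{8n},S)$ is a connected integral graph, whose spectrum is $$\mathrm{Spec}(\mathrm{Cay}(T_{8n},S))=\left\{[7n-1],\,[-n-1]^3,\,[n-1]^4,\,[-1]^{8(n-1)}\right\}.$$
   Context: $T_{8n}=\langle a,b\mid a^{2n}=b^8=e,\ a^n=b^4,\ b^{ -1}ab=a^{ -1}\rangle$ is a group of order $8n$ with elements $a^rb^s$, $0\le r\le 2n-1$, $0\le s\le 3$. For a finite group $G$ with identity $e$ and a nonempty $S\subseteq G\setminus\{e\}$ with $S=S^{ -1}$, $\mathrm{Cay}(G,S)$ is the graph with vertex set $G$ in which $x,y$ are adjacent iff $xy^{ -1}\in S$. A graph is integral if all eigenvalues of its adjacency matrix are integers. $\mathrm{Spec}$ is the multiset of adjacency eigenvalues; $[\lambda]^m$ means $\lambda$ occurs with multiplicity $m$ ($m$ omitted if $m=1$). -}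

module Defs where

open import Algebra.Apartness.Bundles using (HeytingField; HeytingCommutativeRing)
open import Algebra.Bundles using (Group; CommutativeRing)
open import Algebra.Core using (Op₁; Op₂)
import Algebra.Definitions.RawMonoid as RawMonoidDefinitions
import Algebra.Properties.Group as GroupProperties
open import Data.Bool.Base using (if_then_else_)
open import Data.Empty using (⊥-elim)
open import Data.Fin.Base using (Fin; suc; toℕ; fromℕ<; combine; remQuot)
open import Data.Fin.Patterns using (0F; 1F; 2F; 3F)
import Data.Fin.Properties as Fin
open import Data.Integer.Base as ℤ using (ℤ; +_; -[1+_])
import Data.Integer.DivMod as ℤ
open import Data.Integer.Divisibility.Signed as ℤ using (divides)
import Data.Integer.Properties as ℤ
open import Data.Integer.Tactic.RingSolver using (solve-∀)
open import Data.List.Base as List using (List)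
open import Data.List.Relation.Unary.All using (All)
open import Data.List.Relation.Unary.AllPairs using (AllPairs)
open import Data.List.Relation.Unary.Any using (Any)
open import Data.Nat.Base as ℕ using (ℕ; zero; suc; NonZero)
import Data.Nat.Divisibility as ℕ
open import Data.Nat.ListAction using (sum)
import Data.Nat.Properties as ℕ
open import Data.Product.Base using (_×_; _,_; proj₁; proj₂; ∃; ∃-syntax)
open import Data.Sum.Base using (_⊎_; inj₁; inj₂)
open import Data.Vec.Functional using (Vector)
open import Function.Bundles using (Inverse)
open import Level using (0ℓ; _⊔_)
open import Relation.Binary.Bundles using (Setoid)
open import Relation.Binary.Core using (Rel)
open import Relation.Binary.Definitions using (Symmetric; Irreflexive; Decidable; _Respects_; _Respects₂_)
open import Relation.Binary.PropositionalEquality.Core using (_≡_; refl; sym; trans; cong; cong₂; subst)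
import Relation.Binary.PropositionalEquality.Properties as ≡
import Relation.Binary.Reasoning.Setoid as SetoidReasoning
open import Relation.Nullary using (¬_; does)
open import Relation.Nullary.Decidable using (_×-dec_; _⊎-dec_; ¬?; map′)
open import Relation.Unary using (Pred; _∈_; _∉_; _∪_; _∖_)
import Relation.Unary as Unary

record FiniteGraph : Set₁ where
  infix 4 _~_ _~?_
  field
    vertices    : Setoid 0ℓ 0ℓ
    order       : ℕ
    enumeration : Inverse (≡.setoid (Fin order)) vertices

  open Setoid vertices public renaming (Carrier to Vertex) using (_≈_)

  field
    _~_      : Rel Vertex 0ℓ
    ~-resp-≈ : _~_ Respects₂ _≈_
    ~-sym    : Symmetric _~_
    ~-irrefl : Irreflexive _≈_ _~_
    _~?_     : Decidable _~_

  vertex : Fin order → Vertex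
  vertex = Inverse.to enumeration

module _ (Γ : FiniteGraph) where
  open FiniteGraph Γ

  -- Vertices form a setoid, so the trivial walk must allow any equal
  -- representative of its starting point.
  data Walk : Rel Vertex 0ℓ where
    stop : ∀ {x y} → x ≈ y → Walk x y
    step : ∀ {x y z} → x ~ y → Walk y z → Walk x z

  Connected : Set
  Connected = ∀ x y → Walk x y

-- The library has no real numbers, so the field of scalars is an
-- arbitrary Heyting field of characteristic zero.  The reals are one,
-- whether constructed constructively (with x # y meaning ∣x - y∣ > 0)
-- or classically (with x # y meaning x ≉ y).

module _ {c ℓ₁ ℓ₂} (K : HeytingField c ℓ₁ ℓ₂) where
  open HeytingField K
  private
    commutativeRing : CommutativeRing c ℓ₁
    commutativeRing = HeytingCommutativeRing.commutativeRing heytingCommutativeRing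

    module +-Monoid = RawMonoidDefinitions (CommutativeRing.+-rawMonoid commutativeRing)

  CharacteristicZero : Set ℓ₂
  CharacteristicZero = ∀ n → .{{NonZero n}} → (n +-Monoid.× 1#) # 0#

  fromℤ : ℤ → Carrier
  fromℤ (+ n)    = n +-Monoid.× 1#
  fromℤ -[1+ n ] = - (suc n +-Monoid.× 1#)

  module _ {n : ℕ} where

    infix 4 _≋_

    _≋_ : Rel (Vector Carrier n) ℓ₁
    v ≋ w = ∀ i → v i ≈ w i

    linearCombination : ∀ {m} → Vector Carrier m → Vector (Vector Carrier n) m → Vector Carrier n
    linearCombination c v i = +-Monoid.sum (λ j → c j * v j i)

    LinearlyIndependent : ∀ {m} → Vector (Vector Carrier n) m → Set (c ⊔ ℓ₁)
    LinearlyIndependent v =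
      ∀ c → linearCombination c v ≋ (λ _ → 0#) → ∀ j → c j ≈ 0#

    record IsBasis (W : Pred (Vector Carrier n) ℓ₁) {m} (v : Vector (Vector Carrier n) m) : Set (c ⊔ ℓ₁) where
      field
        members     : ∀ j → v j ∈ W
        independent : LinearlyIndependent v
        spanning    : ∀ {w} → w ∈ W → ∃[ c ] w ≋ linearCombination c v

    HasDimension : Pred (Vector Carrier n) ℓ₁ → ℕ → Set (c ⊔ ℓ₁)
    HasDimension W m = ∃ λ (v : Vector (Vector Carrier n) m) → IsBasis W v

    Matrix : Set c
    Matrix = Fin n → Fin n → Carrier

    _·_ : Matrix → Vector Carrier n → Vector Carrier n
    (A · v) i = +-Monoid.sum (λ j → A i j * v j)

    Eigenspace : Matrix → Carrier → Pred (Vector Carrier n) ℓ₁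
    Eigenspace A θ v = A · v ≋ (λ i → θ * v i)

    -- An eigenvector is nonzero in the sense of apartness: some
    -- coordinate is apart from 0.
    IsEigenvalue : Matrix → Carrier → Set (c ⊔ ℓ₁ ⊔ ℓ₂)
    IsEigenvalue A θ = ∃[ v ] v ∈ Eigenspace A θ × (∃[ i ] v i # 0#)

  adjacencyMatrix : (Γ : FiniteGraph) → Matrix {FiniteGraph.order Γ}
  adjacencyMatrix Γ i j = if does (vertex i ~? vertex j) then 1# else 0#
    where open FiniteGraph Γ using (vertex; _~?_)

  Integral : FiniteGraph → Set (c ⊔ ℓ₁ ⊔ ℓ₂)
  Integral Γ = ∀ θ → IsEigenvalue (adjacencyMatrix Γ) θ → ∃[ z ] θ ≈ fromℤ z

  -- A multiset of eigenvalues is written as a list of pairs (θ , m),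
  -- standing for [θ]ᵐ, with pairwise distinct θ; m = 0 is allowed.
  -- Adjacency matrices are symmetric, so the multiplicity of θ is the
  -- dimension of its eigenspace.  Over a general K, the condition
  -- `total` says that the matrix is diagonalisable, which makes these
  -- multiplicities the algebraic ones as well.
  record HasSpectrum (Γ : FiniteGraph) (spec : List (Carrier × ℕ)) : Set (c ⊔ ℓ₁ ⊔ ℓ₂) where
    private
      A = adjacencyMatrix Γ
    field
      distinct       : AllPairs (λ p q → proj₁ p # proj₁ q) spec
      multiplicities : All (λ p → HasDimension (Eigenspace A (proj₁ p)) (proj₂ p)) spec
      exhaustive     : ∀ θ → IsEigenvalue A θ → Any (λ p → θ ≈ proj₁ p) spec
      total          : sum (List.map proj₂ spec) ≡ FiniteGraph.order Γ

infix 6 [_]^_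

[_]^_ : ∀ {c} {C : Set c} → C → ℕ → C × ℕ
[ θ ]^ m = θ , m

module Power {c} {C : Set c} (_∙_ : Op₂ C) (ε : C) (_⁻¹ : Op₁ C) where

  infixr 8 _^_

  private
    _^ℕ_ : C → ℕ → C
    x ^ℕ zero  = ε
    x ^ℕ suc n = x ∙ (x ^ℕ n)

  _^_ : C → ℤ → C
  x ^ (+ n)    = x ^ℕ n
  x ^ -[1+ n ] = (x ^ℕ suc n) ⁻¹

module _ (G : Group 0ℓ 0ℓ) where
  open Group G
  open Power _∙_ ε _⁻¹

  Cyclic : Carrier → Pred Carrier 0ℓ
  Cyclic g x = ∃[ k ] x ≈ g ^ k

  RightCoset : Pred Carrier 0ℓ → Carrier → Pred Carrier 0ℓ
  RightCoset H g x = ∃[ h ] h ∈ H × x ≈ h ∙ g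

module PowerProperties (G : Group 0ℓ 0ℓ) where
  open Group G
  open Power _∙_ ε _⁻¹
  open GroupProperties G
  open SetoidReasoning setoid
  private
    module G = Group G

  ^-suc : ∀ x k → x ^ ℤ.suc k ≈ x ∙ x ^ k
  ^-suc x (+ n)        = G.refl
  ^-suc x -[1+ zero ]  = begin
    ε               ≈⟨ inverseʳ x ⟨
    x ∙ x ⁻¹        ≈⟨ ∙-congˡ (⁻¹-cong (identityʳ x)) ⟨
    x ∙ (x ∙ ε) ⁻¹  ∎
  ^-suc x -[1+ suc n ] = begin
    y ⁻¹               ≈⟨ \\-leftDividesˡ x (y ⁻¹) ⟨
    x ∙ (x ⁻¹ ∙ y ⁻¹)  ≈⟨ ∙-congˡ (⁻¹-anti-homo-∙ y x) ⟨
    x ∙ (y ∙ x) ⁻¹     ≈⟨ ∙-congˡ (⁻¹-cong (commutes (suc n))) ⟨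
    x ∙ (x ∙ y) ⁻¹     ∎
    where
    y = x ^ (+ suc n)
    commutes : ∀ m → x ∙ x ^ (+ m) ≈ x ^ (+ m) ∙ x
    commutes zero    = G.trans (identityʳ x) (G.sym (identityˡ x))
    commutes (suc m) = G.trans (∙-congˡ (commutes m)) (G.sym (assoc _ _ _))

  ^-unique : ∀ (f : ℤ → Carrier) x → (∀ k → f (ℤ.suc k) ≈ x ∙ f k) →
             ∀ k → f k ≈ x ^ k ∙ f (+ 0)
  ^-unique f x f-suc (+ zero)  = G.sym (identityˡ _)
  ^-unique f x f-suc (+ suc n) = begin
    f (+ suc n)                ≈⟨ f-suc (+ n) ⟩
    x ∙ f (+ n)                ≈⟨ ∙-congˡ (^-unique f x f-suc (+ n)) ⟩
    x ∙ (x ^ (+ n) ∙ f (+ 0))  ≈⟨ assoc _ _ _ ⟨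
    x ^ (+ suc n) ∙ f (+ 0)    ∎
  ^-unique f x f-suc -[1+ n ]  = ∙-cancelˡ x _ _ (begin
    x ∙ f -[1+ n ]                    ≈⟨ f-suc -[1+ n ] ⟨
    f (ℤ.suc -[1+ n ])                ≈⟨ previous n ⟩
    x ^ (ℤ.suc -[1+ n ]) ∙ f (+ 0)    ≈⟨ ∙-congʳ (^-suc x -[1+ n ]) ⟩
    x ∙ x ^ -[1+ n ] ∙ f (+ 0)        ≈⟨ assoc _ _ _ ⟩
    x ∙ (x ^ -[1+ n ] ∙ f (+ 0))      ∎)
    where
    previous : ∀ n → f (ℤ.suc -[1+ n ]) ≈ x ^ (ℤ.suc -[1+ n ]) ∙ f (+ 0)
    previous zero    = ^-unique f x f-suc (+ 0)
    previous (suc n) = ^-unique f x f-suc -[1+ n ]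

  ^-+ : ∀ x j k → x ^ (j ℤ.+ k) ≈ x ^ j ∙ x ^ k
  ^-+ x j k = begin
    x ^ (j ℤ.+ k)          ≈⟨ ^-unique (λ i → x ^ (i ℤ.+ k)) x suc-step j ⟩
    x ^ j ∙ x ^ (+ 0 ℤ.+ k) ≡⟨ cong (λ i → x ^ j ∙ x ^ i) (ℤ.+-identityˡ k) ⟩
    x ^ j ∙ x ^ k          ∎
    where
    suc-step : ∀ i → x ^ (ℤ.suc i ℤ.+ k) ≈ x ∙ x ^ (i ℤ.+ k)
    suc-step i = begin
      x ^ (ℤ.suc i ℤ.+ k)    ≡⟨ cong (x ^_) (ℤ.+-assoc (+ 1) i k) ⟩
      x ^ (ℤ.suc (i ℤ.+ k))  ≈⟨ ^-suc x (i ℤ.+ k) ⟩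
      x ∙ x ^ (i ℤ.+ k)      ∎

  ^-* : ∀ x j k → x ^ (k ℤ.* j) ≈ (x ^ j) ^ k
  ^-* x j k = begin
    x ^ (k ℤ.* j)  ≈⟨ ^-unique (λ i → x ^ (i ℤ.* j)) (x ^ j) suc-step k ⟩
    (x ^ j) ^ k ∙ ε  ≈⟨ identityʳ _ ⟩
    (x ^ j) ^ k  ∎
    where
    suc-step : ∀ i → x ^ (ℤ.suc i ℤ.* j) ≈ x ^ j ∙ x ^ (i ℤ.* j)
    suc-step i = begin
      x ^ (ℤ.suc i ℤ.* j)      ≡⟨ cong (x ^_) (ℤ.suc-* i j) ⟩
      x ^ (j ℤ.+ i ℤ.* j)      ≈⟨ ^-+ x j (i ℤ.* j) ⟩
      x ^ j ∙ x ^ (i ℤ.* j)    ∎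

  ^-neg : ∀ x k → x ^ (ℤ.- k) ≈ (x ^ k) ⁻¹
  ^-neg x k = inverseˡ-unique _ _ (begin
    x ^ (ℤ.- k) ∙ x ^ k  ≈⟨ ^-+ x (ℤ.- k) k ⟨
    x ^ (ℤ.- k ℤ.+ k)    ≡⟨ cong (x ^_) (ℤ.+-inverseˡ k) ⟩
    ε                    ∎)

  ^-cong : ∀ {x y} k → x ≈ y → x ^ k ≈ y ^ k
  ^-cong {x} {y} k x≈y = begin
    x ^ k      ≈⟨ ^-unique (x ^_) y (λ i → G.trans (^-suc x i) (∙-congʳ x≈y)) k ⟩
    y ^ k ∙ ε  ≈⟨ identityʳ _ ⟩
    y ^ k      ∎

  ε^ : ∀ k → ε ^ k ≈ ε
  ε^ k = G.sym (G.trans (^-unique (λ _ → ε) ε (λ _ → G.sym (identityˡ ε)) k) (identityʳ _))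

record FiniteGroup : Set₁ where
  field
    group       : Group 0ℓ 0ℓ
    order       : ℕ
    enumeration : Inverse (≡.setoid (Fin order)) (Group.setoid group)

record ConnectionSet (G : Group 0ℓ 0ℓ) : Set₁ where
  open Group G
  field
    S         : Pred Carrier 0ℓ
    S?        : Unary.Decidable S
    S-resp-≈  : S Respects _≈_
    nonempty  : Unary.Satisfiable S
    ε∉S       : ε ∉ S
    ⁻¹-closed : ∀ {x} → x ∈ S → x ⁻¹ ∈ S

Cay : (G : FiniteGroup) → ConnectionSet (FiniteGroup.group G) → FiniteGraph
Cay G C = record
  { vertices    = setoid
  ; order       = FiniteGroup.order G
  ; enumeration = FiniteGroup.enumeration G
  ; _~_         = λ x y → x ∙ y ⁻¹ ∈ S
  ; ~-resp-≈    = (λ y≈z → S-resp-≈ (∙-congˡ (⁻¹-cong y≈z))) , (λ x≈y → S-resp-≈ (∙-congʳ x≈y))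
  ; ~-sym       = λ {x} {y} xy⁻¹∈S → S-resp-≈
      (G.trans (⁻¹-anti-homo-∙ x (y ⁻¹)) (∙-congʳ (⁻¹-involutive y))) (⁻¹-closed xy⁻¹∈S)
  ; ~-irrefl    = λ {x} {y} x≈y xy⁻¹∈S → ε∉S (S-resp-≈ (G.trans (∙-congʳ x≈y) (inverseʳ y)) xy⁻¹∈S)
  ; _~?_        = λ x y → S? (x ∙ y ⁻¹)
  }
  where
  open Group (FiniteGroup.group G)
  open GroupProperties (FiniteGroup.group G)
  open ConnectionSet C
  module G = Group (FiniteGroup.group G)

infixl 7 _∙_
infix  8 _⁻¹

data Word (X : Set) : Set where
  gen : X → Word X
  ε   : Word X
  _∙_ : Word X → Word X → Word X
  _⁻¹ : Word X → Word X

module Presentation {X : Set} (R : Rel (Word X) 0ℓ) where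

  infix 4 _≈_

  data _≈_ : Rel (Word X) 0ℓ where
    relation  : ∀ {u v} → R u v → u ≈ v
    ≈-refl    : ∀ {u} → u ≈ u
    ≈-sym     : ∀ {u v} → u ≈ v → v ≈ u
    ≈-trans   : ∀ {u v w} → u ≈ v → v ≈ w → u ≈ w
    ∙-cong    : ∀ {u u′ v v′} → u ≈ u′ → v ≈ v′ → u ∙ v ≈ u′ ∙ v′
    ⁻¹-cong   : ∀ {u v} → u ≈ v → u ⁻¹ ≈ v ⁻¹
    assoc     : ∀ u v w → (u ∙ v) ∙ w ≈ u ∙ (v ∙ w)
    identityˡ : ∀ u → ε ∙ u ≈ u
    identityʳ : ∀ u → u ∙ ε ≈ u
    inverseˡ  : ∀ u → u ⁻¹ ∙ u ≈ ε
    inverseʳ  : ∀ u → u ∙ u ⁻¹ ≈ ε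

  group : Group 0ℓ 0ℓ
  group = record
    { _≈_ = _≈_ ; _∙_ = _∙_ ; ε = ε ; _⁻¹ = _⁻¹
    ; isGroup = record
      { isMonoid = record
        { isSemigroup = record
          { isMagma = record
            { isEquivalence = record { refl = ≈-refl ; sym = ≈-sym ; trans = ≈-trans }
            ; ∙-cong = ∙-cong }
          ; assoc = assoc }
        ; identity = identityˡ , identityʳ }
      ; inverse = inverseˡ , inverseʳ
      ; ⁻¹-cong = ⁻¹-cong }
    }

module _ {X : Set} where
  open Power {C = Word X} _∙_ ε _⁻¹ public

module T₈ₙ (n : ℕ) where

  data Generator : Set where
    𝕒 𝕓 : Generator

  pattern a = gen 𝕒
  pattern b = gen 𝕓

  data Relation : Rel (Word Generator) 0ℓ where
    a²ⁿ=ε     : Relation (a ^ (+ (2 ℕ.* n))) ε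
    b⁸=ε      : Relation (b ^ (+ 8)) ε
    aⁿ=b⁴     : Relation (a ^ (+ n)) (b ^ (+ 4))
    b⁻¹ab=a⁻¹ : Relation (b ⁻¹ ∙ a ∙ b) (a ⁻¹)

  open Presentation Relation public

  infix 9 ⟨_⟩
  infix 7 _▸_

  ⟨_⟩ : Word Generator → Pred (Word Generator) 0ℓ
  ⟨_⟩ = Cyclic group

  _▸_ : Pred (Word Generator) 0ℓ → Word Generator → Pred (Word Generator) 0ℓ
  _▸_ = RightCoset group

  S₁ S₂ S : Pred (Word Generator) 0ℓ
  S₁ = (⟨ a ^ (+ 2) ⟩ ∖ (_≈ ε)) ∪ (⟨ a ⟩ ▸ b ^ (+ 2))
  S₂ = (⟨ a ⟩ ▸ b) ∪ (⟨ a ⟩ ▸ b ^ (+ 3))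
  S  = S₁ ∪ S₂

  -- T₈ₙ acts on normal forms: (r , s) stands for aʳbˢ, where r only
  -- matters modulo 2n, and act w is left multiplication by w.  It uses
  -- baʳ = a⁻ʳb and, when s = 3, b⁴ = aⁿ.

  NormalForm : Set
  NormalForm = ℤ × Fin 4

  act act⁻¹ : Word Generator → NormalForm → NormalForm

  act a       (r , s)  = ℤ.suc r , s
  act b       (r , 0F) = ℤ.- r , 1F
  act b       (r , 1F) = ℤ.- r , 2F
  act b       (r , 2F) = ℤ.- r , 3F
  act b       (r , 3F) = + n ℤ.- r , 0F
  act ε       x        = x
  act (u ∙ v) x        = act u (act v x)
  act (u ⁻¹)  x        = act⁻¹ u x

  act⁻¹ a       (r , s)  = ℤ.pred r , s
  act⁻¹ b       (r , 0F) = + n ℤ.- r , 3F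
  act⁻¹ b       (r , 1F) = ℤ.- r , 0F
  act⁻¹ b       (r , 2F) = ℤ.- r , 1F
  act⁻¹ b       (r , 3F) = ℤ.- r , 2F
  act⁻¹ ε       x        = x
  act⁻¹ (u ∙ v) x        = act⁻¹ v (act⁻¹ u x)
  act⁻¹ (u ⁻¹)  x        = act u x

  private
    n-[n-r] : ∀ m r → m ℤ.- (m ℤ.- r) ≡ r
    n-[n-r] = solve-∀

  act⁻¹-act : ∀ w x → act⁻¹ w (act w x) ≡ x
  act-act⁻¹ : ∀ w x → act w (act⁻¹ w x) ≡ x

  act⁻¹-act a       (r , s)  = cong (_, s) (ℤ.pred-suc r)
  act⁻¹-act b       (r , 0F) = cong (_, 0F) (ℤ.neg-involutive r)
  act⁻¹-act b       (r , 1F) = cong (_, 1F) (ℤ.neg-involutive r)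
  act⁻¹-act b       (r , 2F) = cong (_, 2F) (ℤ.neg-involutive r)
  act⁻¹-act b       (r , 3F) = cong (_, 3F) (n-[n-r] (+ n) r)
  act⁻¹-act ε       x        = refl
  act⁻¹-act (u ∙ v) x        = trans (cong (act⁻¹ v) (act⁻¹-act u (act v x))) (act⁻¹-act v x)
  act⁻¹-act (u ⁻¹)  x        = act-act⁻¹ u x

  act-act⁻¹ a       (r , s)  = cong (_, s) (ℤ.suc-pred r)
  act-act⁻¹ b       (r , 0F) = cong (_, 0F) (n-[n-r] (+ n) r)
  act-act⁻¹ b       (r , 1F) = cong (_, 1F) (ℤ.neg-involutive r)
  act-act⁻¹ b       (r , 2F) = cong (_, 2F) (ℤ.neg-involutive r)
  act-act⁻¹ b       (r , 3F) = cong (_, 3F) (ℤ.neg-involutive r)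
  act-act⁻¹ ε       x        = refl
  act-act⁻¹ (u ∙ v) x        = trans (cong (act u) (act-act⁻¹ v (act⁻¹ u x))) (act-act⁻¹ u x)
  act-act⁻¹ (u ⁻¹)  x        = act⁻¹-act u x

  infix 4 _≋₂ₙ_

  record _≋₂ₙ_ (x y : NormalForm) : Set where
    constructor _,_
    field
      a-exponents : + (2 ℕ.* n) ℤ.∣ proj₁ x ℤ.- proj₁ y
      b-exponents : proj₂ x ≡ proj₂ y

  private
    ≋-refl : ∀ {x} → x ≋₂ₙ x
    ≋-refl {r , s} = divides (+ 0) (ℤ.+-inverseʳ r) , refl

    ≋-reflexive : ∀ {x y} → x ≡ y → x ≋₂ₙ y
    ≋-reflexive refl = ≋-refl

    ≋-sym : ∀ {x y} → x ≋₂ₙ y → y ≋₂ₙ x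
    ≋-sym {r , s} {r′ , s′} (p , q) = subst (+ (2 ℕ.* n) ℤ.∣_) (eq r r′) (ℤ.∣m⇒∣-m p) , sym q
      where
      eq : ∀ r r′ → ℤ.- (r ℤ.- r′) ≡ r′ ℤ.- r
      eq = solve-∀

    ≋-trans : ∀ {x y z} → x ≋₂ₙ y → y ≋₂ₙ z → x ≋₂ₙ z
    ≋-trans {r , s} {r′ , s′} {r″ , s″} (p , q) (p′ , q′) =
      subst (+ (2 ℕ.* n) ℤ.∣_) (eq r r′ r″) (ℤ.∣m∣n⇒∣m+n p p′) , trans q q′
      where
      eq : ∀ r r′ r″ → (r ℤ.- r′) ℤ.+ (r′ ℤ.- r″) ≡ r ℤ.- r″
      eq = solve-∀

    suc-diff : ∀ r r′ → r ℤ.- r′ ≡ (+ 1 ℤ.+ r) ℤ.- (+ 1 ℤ.+ r′)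
    suc-diff = solve-∀
    pred-diff : ∀ r r′ → r ℤ.- r′ ≡ (ℤ.- + 1 ℤ.+ r) ℤ.- (ℤ.- + 1 ℤ.+ r′)
    pred-diff = solve-∀
    neg-diff : ∀ r r′ → ℤ.- (r ℤ.- r′) ≡ (ℤ.- r) ℤ.- (ℤ.- r′)
    neg-diff = solve-∀
    shift-diff : ∀ m r r′ → ℤ.- (r ℤ.- r′) ≡ (m ℤ.- r) ℤ.- (m ℤ.- r′)
    shift-diff = solve-∀

    neg-∣ : ∀ {r r′} → + (2 ℕ.* n) ℤ.∣ r ℤ.- r′ → + (2 ℕ.* n) ℤ.∣ (ℤ.- r) ℤ.- (ℤ.- r′)
    neg-∣ {r} {r′} p = subst (_ ℤ.∣_) (neg-diff r r′) (ℤ.∣m⇒∣-m p)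

    shift-∣ : ∀ {r r′} → + (2 ℕ.* n) ℤ.∣ r ℤ.- r′ → + (2 ℕ.* n) ℤ.∣ (+ n ℤ.- r) ℤ.- (+ n ℤ.- r′)
    shift-∣ {r} {r′} p = subst (_ ℤ.∣_) (shift-diff (+ n) r r′) (ℤ.∣m⇒∣-m p)

  act-cong   : ∀ w {x y} → x ≋₂ₙ y → act w x ≋₂ₙ act w y
  act⁻¹-cong : ∀ w {x y} → x ≋₂ₙ y → act⁻¹ w x ≋₂ₙ act⁻¹ w y

  act-cong a       {r , _}  {r′ , _} (p , q)    = subst (_ ℤ.∣_) (suc-diff r r′) p , q
  act-cong b       {r , 0F} {r′ , _} (p , refl) = neg-∣ {r} p , refl
  act-cong b       {r , 1F} {r′ , _} (p , refl) = neg-∣ {r} p , refl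
  act-cong b       {r , 2F} {r′ , _} (p , refl) = neg-∣ {r} p , refl
  act-cong b       {r , 3F} {r′ , _} (p , refl) = shift-∣ {r} p , refl
  act-cong ε       x≋y = x≋y
  act-cong (u ∙ v) x≋y = act-cong u (act-cong v x≋y)
  act-cong (u ⁻¹)  x≋y = act⁻¹-cong u x≋y

  act⁻¹-cong a       {r , _}  {r′ , _} (p , q)    = subst (_ ℤ.∣_) (pred-diff r r′) p , q
  act⁻¹-cong b       {r , 0F} {r′ , _} (p , refl) = shift-∣ {r} p , refl
  act⁻¹-cong b       {r , 1F} {r′ , _} (p , refl) = neg-∣ {r} p , refl
  act⁻¹-cong b       {r , 2F} {r′ , _} (p , refl) = neg-∣ {r} p , refl
  act⁻¹-cong b       {r , 3F} {r′ , _} (p , refl) = neg-∣ {r} p , refl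
  act⁻¹-cong ε       x≋y = x≋y
  act⁻¹-cong (u ∙ v) x≋y = act⁻¹-cong v (act⁻¹-cong u x≋y)
  act⁻¹-cong (u ⁻¹)  x≋y = act-cong u x≋y

  act-a^ : ∀ k r s → act (a ^ k) (r , s) ≡ (k ℤ.+ r , s)
  act-a^ (+ k)    r s = helper k r s
    where
    helper : ∀ k r s → act (a ^ (+ k)) (r , s) ≡ (+ k ℤ.+ r , s)
    helper zero    r s = cong (_, s) (sym (ℤ.+-identityˡ r))
    helper (suc k) r s = trans (cong (act a) (helper k r s)) (cong (_, s) (sym (ℤ.+-assoc (+ 1) (+ k) r)))
  act-a^ -[1+ k ] r s =
    trans (cong (λ i → act (a ^ -[1+ k ]) (i , s)) (eq (+ suc k) r))
    (trans (cong (act⁻¹ (a ^ (+ suc k))) (sym (act-a^ (+ suc k) (-[1+ k ] ℤ.+ r) s)))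
      (act⁻¹-act (a ^ (+ suc k)) (-[1+ k ] ℤ.+ r , s)))
    where
    eq : ∀ m r → r ≡ m ℤ.+ (ℤ.- m ℤ.+ r)
    eq = solve-∀

  private
    -2n : ℤ.- (+ 1) ℤ.* (+ 2 ℤ.* + n) ≡ ℤ.- (+ 1) ℤ.* + (2 ℕ.* n)
    -2n = cong (ℤ.- (+ 1) ℤ.*_) (sym (ℤ.pos-* 2 n))

    act-b⁴ : ∀ r s → act (b ^ (+ 4)) (r , s) ≋₂ₙ (+ n ℤ.+ r , s)
    act-b⁴ r 0F = divides (+ 0) (eq (+ n) r) , refl
      where
      eq : ∀ m r → (m ℤ.- (ℤ.- (ℤ.- (ℤ.- r)))) ℤ.- (m ℤ.+ r) ≡ + 0
      eq = solve-∀
    act-b⁴ r 1F = divides (ℤ.- (+ 1)) (trans (eq (+ n) r) -2n) , refl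
      where
      eq : ∀ m r → ℤ.- (m ℤ.- ℤ.- (ℤ.- r)) ℤ.- (m ℤ.+ r) ≡ ℤ.- (+ 1) ℤ.* (+ 2 ℤ.* m)
      eq = solve-∀
    act-b⁴ r 2F = divides (+ 0) (eq (+ n) r) , refl
      where
      eq : ∀ m r → ℤ.- (ℤ.- (m ℤ.- (ℤ.- r))) ℤ.- (m ℤ.+ r) ≡ + 0
      eq = solve-∀
    act-b⁴ r 3F = divides (ℤ.- (+ 1)) (trans (eq (+ n) r) -2n) , refl
      where
      eq : ∀ m r → ℤ.- (ℤ.- (ℤ.- (m ℤ.- r))) ℤ.- (m ℤ.+ r) ≡ ℤ.- (+ 1) ℤ.* (+ 2 ℤ.* m)
      eq = solve-∀

    2n-step : ∀ r s → (+ (2 ℕ.* n) ℤ.+ r , s) ≋₂ₙ (r , s)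
    2n-step r s = divides (+ 1) (eq (+ (2 ℕ.* n)) r) , refl
      where
      eq : ∀ m r → (m ℤ.+ r) ℤ.- r ≡ + 1 ℤ.* m
      eq = solve-∀

    act-b⁻¹ab : ∀ r s → act (b ⁻¹ ∙ a ∙ b) (r , s) ≡ (ℤ.pred r , s)
    act-b⁻¹ab r s = helper s
      where
      eq : ∀ r → ℤ.- (+ 1 ℤ.+ ℤ.- r) ≡ ℤ.- + 1 ℤ.+ r
      eq = solve-∀
      eq′ : ∀ m r → m ℤ.- (+ 1 ℤ.+ (m ℤ.- r)) ≡ ℤ.- + 1 ℤ.+ r
      eq′ = solve-∀
      helper : ∀ s → act (b ⁻¹ ∙ a ∙ b) (r , s) ≡ (ℤ.pred r , s)
      helper 0F = cong (_, 0F) (eq r)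
      helper 1F = cong (_, 1F) (eq r)
      helper 2F = cong (_, 2F) (eq r)
      helper 3F = cong (_, 3F) (eq′ (+ n) r)

    act-b⁸ : ∀ r s → act (b ^ (+ 8)) (r , s) ≋₂ₙ (r , s)
    act-b⁸ r s =
      ≋-trans (act-cong (b ^ (+ 4)) (act-b⁴ r s))
      (≋-trans (act-b⁴ (+ n ℤ.+ r) s)
      (≋-trans (≋-reflexive (cong (_, s) (trans (eq (+ n) r) (cong (ℤ._+ r) (sym (ℤ.pos-* 2 n))))))
      (2n-step r s)))
      where
      eq : ∀ m r → m ℤ.+ (m ℤ.+ r) ≡ + 2 ℤ.* m ℤ.+ r
      eq = solve-∀

  act-relation : ∀ {u v} → Relation u v → ∀ x → act u x ≋₂ₙ act v x
  act-relation a²ⁿ=ε     (r , s) = ≋-trans (≋-reflexive (act-a^ (+ (2 ℕ.* n)) r s)) (2n-step r s)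
  act-relation b⁸=ε      (r , s) = act-b⁸ r s
  act-relation aⁿ=b⁴     (r , s) = ≋-trans (≋-reflexive (act-a^ (+ n) r s)) (≋-sym (act-b⁴ r s))
  act-relation b⁻¹ab=a⁻¹ (r , s) = ≋-reflexive (act-b⁻¹ab r s)

  act-sound : ∀ {u v} → u ≈ v → ∀ x → act u x ≋₂ₙ act v x
  act-sound (relation uRv)        x = act-relation uRv x
  act-sound ≈-refl                x = ≋-refl
  act-sound (≈-sym p)             x = ≋-sym (act-sound p x)
  act-sound (≈-trans p q)         x = ≋-trans (act-sound p x) (act-sound q x)
  act-sound (∙-cong {u} {u′} {v} {v′} p q) x = ≋-trans (act-cong u (act-sound q x)) (act-sound p (act v′ x))
  act-sound (⁻¹-cong {u} {v} p)   x =
    ≋-trans (≋-sym (≋-reflexive (act⁻¹-act v (act⁻¹ u x))))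
    (act⁻¹-cong v (≋-trans (≋-sym (act-sound p (act⁻¹ u x))) (≋-reflexive (act-act⁻¹ u x))))
  act-sound (assoc u v w)         x = ≋-refl
  act-sound (identityˡ u)         x = ≋-refl
  act-sound (identityʳ u)         x = ≋-refl
  act-sound (inverseˡ u)          x = ≋-reflexive (act⁻¹-act u x)
  act-sound (inverseʳ u)          x = ≋-reflexive (act-act⁻¹ u x)

  private
    module T = Group group
  open PowerProperties group
  open GroupProperties group using (\\-leftDividesˡ)
  open SetoidReasoning T.setoid

  normalWord : NormalForm → Word Generator
  normalWord (r , s) = a ^ r ∙ b ^ (+ toℕ s)

  a^-cong-mod : ∀ {r r′} → + (2 ℕ.* n) ℤ.∣ r ℤ.- r′ → a ^ r ≈ a ^ r′
  a^-cong-mod {r} {r′} (divides q r-r′≡q2n) = begin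
    a ^ r                                 ≡⟨ cong (a ^_) (trans (eq r r′) (cong (ℤ._+ r′) r-r′≡q2n)) ⟩
    a ^ (q ℤ.* + (2 ℕ.* n) ℤ.+ r′)        ≈⟨ ^-+ a (q ℤ.* + (2 ℕ.* n)) r′ ⟩
    a ^ (q ℤ.* + (2 ℕ.* n)) ∙ a ^ r′      ≈⟨ T.∙-congʳ (^-* a (+ (2 ℕ.* n)) q) ⟩
    (a ^ (+ (2 ℕ.* n))) ^ q ∙ a ^ r′      ≈⟨ T.∙-congʳ (^-cong q (relation a²ⁿ=ε)) ⟩
    ε ^ q ∙ a ^ r′                        ≈⟨ T.∙-congʳ (ε^ q) ⟩
    ε ∙ a ^ r′                            ≈⟨ identityˡ _ ⟩
    a ^ r′                                ∎
    where
    eq : ∀ r r′ → r ≡ (r ℤ.- r′) ℤ.+ r′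
    eq = solve-∀

  normalWord-cong : ∀ {x y} → x ≋₂ₙ y → normalWord x ≈ normalWord y
  normalWord-cong {r , s} {r′ , _} (p , refl) = T.∙-congʳ (a^-cong-mod {r} {r′} p)

  private
    ba≈a⁻¹b : b ∙ a ≈ a ⁻¹ ∙ b
    ba≈a⁻¹b = begin
      b ∙ a                      ≈⟨ ∙-cong {b} {b} ≈-refl conj ⟩
      b ∙ (b ⁻¹ ∙ (a ⁻¹ ∙ b))    ≈⟨ \\-leftDividesˡ b _ ⟩
      a ⁻¹ ∙ b                   ∎
      where
      aba≈b : a ∙ b ∙ a ≈ b
      aba≈b = begin
        a ∙ b ∙ a                           ≈⟨ T.∙-congʳ (\\-leftDividesˡ b (a ∙ b)) ⟨
        b ∙ (b ⁻¹ ∙ (a ∙ b)) ∙ a            ≈⟨ T.∙-congʳ (T.∙-congˡ (assoc _ _ _)) ⟨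
        b ∙ (b ⁻¹ ∙ a ∙ b) ∙ a              ≈⟨ T.∙-congʳ (T.∙-congˡ (relation b⁻¹ab=a⁻¹)) ⟩
        b ∙ a ⁻¹ ∙ a                        ≈⟨ assoc _ _ _ ⟩
        b ∙ (a ⁻¹ ∙ a)                      ≈⟨ T.∙-congˡ (inverseˡ a) ⟩
        b ∙ ε                               ≈⟨ identityʳ b ⟩
        b                                   ∎
      conj : a ≈ b ⁻¹ ∙ (a ⁻¹ ∙ b)
      conj = begin
        a                                   ≈⟨ GroupProperties.\\-leftDividesʳ group b a ⟨
        b ⁻¹ ∙ (b ∙ a)                      ≈⟨ T.∙-congˡ (GroupProperties.\\-leftDividesʳ group a (b ∙ a)) ⟨
        b ⁻¹ ∙ (a ⁻¹ ∙ (a ∙ (b ∙ a)))       ≈⟨ T.∙-congˡ (T.∙-congˡ (assoc _ _ _)) ⟨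
        b ⁻¹ ∙ (a ⁻¹ ∙ (a ∙ b ∙ a))         ≈⟨ T.∙-congˡ (T.∙-congˡ aba≈b) ⟩
        b ⁻¹ ∙ (a ⁻¹ ∙ b)                   ∎

    ba^ : ∀ k → b ∙ a ^ k ≈ a ^ (ℤ.- k) ∙ b
    ba^ k = begin
      b ∙ a ^ k                ≈⟨ ^-unique (λ i → b ∙ a ^ i) (a ⁻¹) suc-step k ⟩
      (a ⁻¹) ^ k ∙ (b ∙ ε)     ≈⟨ T.∙-congˡ (identityʳ b) ⟩
      (a ⁻¹) ^ k ∙ b           ≈⟨ T.∙-congʳ (^-cong k (⁻¹-cong (identityʳ a))) ⟨
      (a ^ -[1+ 0 ]) ^ k ∙ b   ≈⟨ T.∙-congʳ (^-* a -[1+ 0 ] k) ⟨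
      a ^ (k ℤ.* -[1+ 0 ]) ∙ b ≡⟨ cong (λ i → a ^ i ∙ b) (eq k) ⟩
      a ^ (ℤ.- k) ∙ b          ∎
      where
      eq : ∀ k → k ℤ.* (ℤ.- + 1) ≡ ℤ.- k
      eq = solve-∀
      suc-step : ∀ i → b ∙ a ^ (ℤ.suc i) ≈ a ⁻¹ ∙ (b ∙ a ^ i)
      suc-step i = begin
        b ∙ a ^ (ℤ.suc i)   ≈⟨ T.∙-congˡ (^-suc a i) ⟩
        b ∙ (a ∙ a ^ i)     ≈⟨ assoc _ _ _ ⟨
        b ∙ a ∙ a ^ i       ≈⟨ T.∙-congʳ ba≈a⁻¹b ⟩
        a ⁻¹ ∙ b ∙ a ^ i    ≈⟨ assoc _ _ _ ⟩
        a ⁻¹ ∙ (b ∙ a ^ i)  ∎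

    b-normalWord : ∀ r k → b ∙ (a ^ r ∙ b ^ (+ k)) ≈ a ^ (ℤ.- r) ∙ b ^ (+ suc k)
    b-normalWord r k = begin
      b ∙ (a ^ r ∙ b ^ (+ k))          ≈⟨ assoc _ _ _ ⟨
      b ∙ a ^ r ∙ b ^ (+ k)            ≈⟨ T.∙-congʳ (ba^ r) ⟩
      a ^ (ℤ.- r) ∙ b ∙ b ^ (+ k)      ≈⟨ assoc _ _ _ ⟩
      a ^ (ℤ.- r) ∙ b ^ (+ suc k)      ∎

    generator-normalWord : ∀ g x → gen g ∙ normalWord x ≈ normalWord (act (gen g) x)
    generator-normalWord 𝕒 (r , s) = begin
      a ∙ (a ^ r ∙ b ^ (+ toℕ s))      ≈⟨ assoc _ _ _ ⟨
      a ∙ a ^ r ∙ b ^ (+ toℕ s)        ≈⟨ T.∙-congʳ (^-suc a r) ⟨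
      a ^ (ℤ.suc r) ∙ b ^ (+ toℕ s)    ∎
    generator-normalWord 𝕓 (r , 0F) = b-normalWord r 0
    generator-normalWord 𝕓 (r , 1F) = b-normalWord r 1
    generator-normalWord 𝕓 (r , 2F) = b-normalWord r 2
    generator-normalWord 𝕓 (r , 3F) = begin
      b ∙ (a ^ r ∙ b ^ (+ 3))          ≈⟨ b-normalWord r 3 ⟩
      a ^ (ℤ.- r) ∙ b ^ (+ 4)          ≈⟨ T.∙-congˡ (relation aⁿ=b⁴) ⟨
      a ^ (ℤ.- r) ∙ a ^ (+ n)          ≈⟨ ^-+ a (ℤ.- r) (+ n) ⟨
      a ^ (ℤ.- r ℤ.+ + n)              ≡⟨ cong (a ^_) (ℤ.+-comm (ℤ.- r) (+ n)) ⟩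
      a ^ (+ n ℤ.- r)                  ≈⟨ identityʳ _ ⟨
      a ^ (+ n ℤ.- r) ∙ ε              ∎

  ∙-normalWord : ∀ w x → w ∙ normalWord x ≈ normalWord (act w x)
  ∙-normalWord (gen g) x = generator-normalWord g x
  ∙-normalWord ε       x = identityˡ _
  ∙-normalWord (u ∙ v) x = begin
    u ∙ v ∙ normalWord x          ≈⟨ assoc _ _ _ ⟩
    u ∙ (v ∙ normalWord x)        ≈⟨ T.∙-congˡ (∙-normalWord v x) ⟩
    u ∙ normalWord (act v x)      ≈⟨ ∙-normalWord u (act v x) ⟩
    normalWord (act u (act v x))  ∎
  ∙-normalWord (u ⁻¹)  x = begin
    u ⁻¹ ∙ normalWord x                      ≡⟨ cong (λ y → u ⁻¹ ∙ normalWord y) (act-act⁻¹ u x) ⟨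
    u ⁻¹ ∙ normalWord (act u (act⁻¹ u x))    ≈⟨ T.∙-congˡ (∙-normalWord u (act⁻¹ u x)) ⟨
    u ⁻¹ ∙ (u ∙ normalWord (act⁻¹ u x))      ≈⟨ GroupProperties.\\-leftDividesʳ group u _ ⟩
    normalWord (act⁻¹ u x)                   ∎

  coordinates : Word Generator → NormalForm
  coordinates w = act w (+ 0 , 0F)

  normalWord-coordinates : ∀ w → w ≈ normalWord (coordinates w)
  normalWord-coordinates w = begin
    w                        ≈⟨ identityʳ w ⟨
    w ∙ ε                    ≈⟨ T.∙-congˡ (identityˡ ε) ⟨
    w ∙ (ε ∙ ε)              ≈⟨ ∙-normalWord w (+ 0 , 0F) ⟩
    normalWord (coordinates w) ∎

  coordinates-normalWord : ∀ x → coordinates (normalWord x) ≡ x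
  coordinates-normalWord (r , s) =
    trans (cong (act (a ^ r)) (helper s)) (trans (act-a^ r (+ 0) s) (cong (_, s) (ℤ.+-identityʳ r)))
    where
    helper : ∀ s → coordinates (b ^ (+ toℕ s)) ≡ (+ 0 , s)
    helper 0F = refl
    helper 1F = refl
    helper 2F = refl
    helper 3F = refl

  ∈⟨a⟩▸⇒ : ∀ {x y} → x ∈ ⟨ a ⟩ ▸ y → proj₂ (coordinates x) ≡ proj₂ (coordinates y)
  ∈⟨a⟩▸⇒ {x} {y} (h , (k , h≈aᵏ) , x≈hy) = trans
    (_≋₂ₙ_.b-exponents (act-sound (T.trans x≈hy (T.∙-congʳ h≈aᵏ)) (+ 0 , 0F)))
    (cong proj₂ (act-a^ k (proj₁ (coordinates y)) (proj₂ (coordinates y))))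

  ∈⟨a⟩▸⇒≢0 : ∀ {x y} → ¬ proj₂ (coordinates y) ≡ 0F → x ∈ ⟨ a ⟩ ▸ y → ¬ proj₂ (coordinates x) ≡ 0F
  ∈⟨a⟩▸⇒≢0 y≢0 p x≡0 = y≢0 (trans (sym (∈⟨a⟩▸⇒ p)) x≡0)

  ⇒∈⟨a⟩▸ : ∀ x y s → y ≈ b ^ (+ toℕ s) → proj₂ (coordinates x) ≡ s → x ∈ ⟨ a ⟩ ▸ y
  ⇒∈⟨a⟩▸ x y _ y≈bˢ refl =
    a ^ r , (r , ≈-refl) , T.trans (normalWord-coordinates x) (T.∙-congˡ (T.sym y≈bˢ))
    where r = proj₁ (coordinates x)

  ∈⟨a²⟩⇒ : ∀ {x} → x ∈ ⟨ a ^ (+ 2) ⟩ → (+ 2 ℤ.∣ proj₁ (coordinates x)) × proj₂ (coordinates x) ≡ 0F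
  ∈⟨a²⟩⇒ {x} (k , x≈a²ᵏ) =
    subst (+ 2 ℤ.∣_) (eq (proj₁ (coordinates x)) (k ℤ.* + 2))
      (ℤ.∣m∣n⇒∣m+n (ℤ.∣-trans 2∣2n (_≋₂ₙ_.a-exponents x≋)) (divides k refl))
    , _≋₂ₙ_.b-exponents x≋
    where
    x≋ : coordinates x ≋₂ₙ (k ℤ.* + 2 ℤ.+ + 0 , 0F)
    x≋ = subst (coordinates x ≋₂ₙ_) (act-a^ (k ℤ.* + 2) (+ 0) 0F)
      (act-sound (T.trans x≈a²ᵏ (T.sym (^-* a (+ 2) k))) (+ 0 , 0F))
    2∣2n : + 2 ℤ.∣ + (2 ℕ.* n)
    2∣2n = divides (+ n) (trans (ℤ.pos-* 2 n) (ℤ.*-comm (+ 2) (+ n)))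
    eq : ∀ r m → (r ℤ.- (m ℤ.+ + 0)) ℤ.+ m ≡ r
    eq = solve-∀

  ⇒∈⟨a²⟩ : ∀ x → (+ 2 ℤ.∣ proj₁ (coordinates x)) × proj₂ (coordinates x) ≡ 0F → x ∈ ⟨ a ^ (+ 2) ⟩
  ⇒∈⟨a²⟩ x (divides q r≡q2 , s≡0) = q , (begin
    x                                                    ≈⟨ normalWord-coordinates x ⟩
    normalWord (coordinates x)                           ≡⟨ cong₂ (λ r s → normalWord (r , s)) r≡q2 s≡0 ⟩
    a ^ (q ℤ.* + 2) ∙ ε                                  ≈⟨ identityʳ _ ⟩
    a ^ (q ℤ.* + 2)                                      ≈⟨ ^-* a (+ 2) q ⟩
    (a ^ (+ 2)) ^ q                                      ∎)

  ≢0⇒∈S : ∀ x → ¬ proj₂ (coordinates x) ≡ 0F → x ∈ S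
  ≢0⇒∈S x s≢0 = helper _ refl
    where
    helper : ∀ s → proj₂ (coordinates x) ≡ s → x ∈ S
    helper 0F s≡0 = ⊥-elim (s≢0 s≡0)
    helper 1F s≡1 = inj₂ (inj₁ (⇒∈⟨a⟩▸ x b 1F (T.sym (identityʳ b)) s≡1))
    helper 2F s≡2 = inj₁ (inj₂ (⇒∈⟨a⟩▸ x (b ^ (+ 2)) 2F ≈-refl s≡2))
    helper 3F s≡3 = inj₂ (inj₂ (⇒∈⟨a⟩▸ x (b ^ (+ 3)) 3F ≈-refl s≡3))

  ≡0-⁻¹ : ∀ x → proj₂ (coordinates (x ⁻¹)) ≡ 0F → proj₂ (coordinates x) ≡ 0F
  ≡0-⁻¹ x s≡0 = ∈⟨a⟩▸⇒ {y = ε} (a ^ (ℤ.- r) , (ℤ.- r , ≈-refl) , (begin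
    x                     ≈⟨ GroupProperties.⁻¹-involutive group x ⟨
    x ⁻¹ ⁻¹               ≈⟨ ⁻¹-cong (normalWord-coordinates (x ⁻¹)) ⟩
    (normalWord (coordinates (x ⁻¹))) ⁻¹ ≡⟨ cong (λ s → (normalWord (r , s)) ⁻¹) s≡0 ⟩
    (a ^ r ∙ ε) ⁻¹        ≈⟨ ⁻¹-cong (identityʳ _) ⟩
    (a ^ r) ⁻¹            ≈⟨ ^-neg a r ⟨
    a ^ (ℤ.- r)           ≈⟨ identityʳ _ ⟨
    a ^ (ℤ.- r) ∙ ε       ∎))
    where r = proj₁ (coordinates (x ⁻¹))

  module _ .{{_ : NonZero n}} where

    private instance
      2n≢0 : NonZero (2 ℕ.* n)
      2n≢0 = ℕ.m*n≢0 2 n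

    fromFin : Fin (2 ℕ.* n ℕ.* 4) → Word Generator
    fromFin i = normalWord (+ toℕ (proj₁ (remQuot {2 ℕ.* n} 4 i)) , proj₂ (remQuot {2 ℕ.* n} 4 i))

    residue : ℤ → Fin (2 ℕ.* n)
    residue r = fromℕ< (ℤ.n%ℕd<d r (2 ℕ.* n))

    toFin : Word Generator → Fin (2 ℕ.* n ℕ.* 4)
    toFin w = combine (residue (proj₁ (coordinates w))) (proj₂ (coordinates w))

    private
      toℕ-residue : ∀ r → + (2 ℕ.* n) ℤ.∣ r ℤ.- + toℕ (residue r)
      toℕ-residue r = divides (r ℤ./ℕ m) (trans
        (cong₂ ℤ._-_ (ℤ.a≡a%ℕn+[a/ℕn]*n r m) (cong +_ (Fin.toℕ-fromℕ< (ℤ.n%ℕd<d r m))))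
        (eq (+ (r ℤ.%ℕ m)) (r ℤ./ℕ m ℤ.* + m)))
        where
        m = 2 ℕ.* n
        eq : ∀ x y → (x ℤ.+ y) ℤ.- x ≡ y
        eq = solve-∀

      congruent⇒≡ : ∀ (i j : Fin (2 ℕ.* n)) → + (2 ℕ.* n) ℤ.∣ + toℕ i ℤ.- + toℕ j → i ≡ j
      congruent⇒≡ i j p = Fin.toℕ-injective (ℤ.+-injective (ℤ.i-j≡0⇒i≡j (+ toℕ i) (+ toℕ j)
        (ℤ.∣i∣≡0⇒i≡0 (multiple<⇒≡0 (ℤ.∣⇒∣ᵤ p) small))))
        where
        multiple<⇒≡0 : ∀ {m k} → m ℕ.∣ k → k ℕ.< m → k ≡ 0
        multiple<⇒≡0 {k = zero}  _   _   = refl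
        multiple<⇒≡0 {k = suc _} m∣k k<m = ⊥-elim (ℕ.>⇒∤ k<m m∣k)
        small : ℤ.∣ + toℕ i ℤ.- + toℕ j ∣ ℕ.< 2 ℕ.* n
        small = ℕ.≤-<-trans
          (subst (ℕ._≤ toℕ i ℕ.⊔ toℕ j) (cong ℤ.∣_∣ (sym (ℤ.m-n≡m⊖n (toℕ i) (toℕ j)))) (ℤ.∣m⊝n∣≤m⊔n (toℕ i) (toℕ j)))
          (ℕ.⊔-lub (Fin.toℕ<n i) (Fin.toℕ<n j))

    fromFin-toFin : ∀ w → fromFin (toFin w) ≈ w
    fromFin-toFin w = begin
      fromFin (toFin w)                   ≡⟨ cong (λ p → normalWord (+ toℕ (proj₁ p) , proj₂ p)) (Fin.remQuot-combine (residue r) s) ⟩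
      normalWord (+ toℕ (residue r) , s)  ≈⟨ normalWord-cong {r , s} {+ toℕ (residue r) , s} (toℕ-residue r , refl) ⟨
      normalWord (r , s)                  ≈⟨ normalWord-coordinates w ⟨
      w                                   ∎
      where
      r = proj₁ (coordinates w)
      s = proj₂ (coordinates w)

    residue-cong : ∀ {r r′} → + (2 ℕ.* n) ℤ.∣ r ℤ.- r′ → residue r ≡ residue r′
    residue-cong {r} {r′} p = congruent⇒≡ (residue r) (residue r′)
      (subst (+ (2 ℕ.* n) ℤ.∣_) (eq r r′ (+ toℕ (residue r)) (+ toℕ (residue r′)))
        (ℤ.∣m∣n⇒∣m-n (ℤ.∣m∣n⇒∣m+n p (toℕ-residue r′)) (toℕ-residue r)))
      where
      eq : ∀ r r′ i j → (r ℤ.- r′) ℤ.+ (r′ ℤ.- j) ℤ.- (r ℤ.- i) ≡ i ℤ.- j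
      eq = solve-∀

    toFin-cong : ∀ {u v} → u ≈ v → toFin u ≡ toFin v
    toFin-cong {u} {v} u≈v with act-sound u≈v (+ 0 , 0F)
    ... | p , q = cong₂ combine (residue-cong {proj₁ (coordinates u)} {proj₁ (coordinates v)} p) q

    toFin-fromFin : ∀ i → toFin (fromFin i) ≡ i
    toFin-fromFin i = trans
      (cong (λ x → combine (residue (proj₁ x)) (proj₂ x)) (coordinates-normalWord (+ toℕ r , s)))
      (trans (cong (λ j → combine j s) (sym (congruent⇒≡ r (residue (+ toℕ r)) (toℕ-residue (+ toℕ r)))))
        (Fin.combine-remQuot {2 ℕ.* n} 4 i))
      where
      r = proj₁ (remQuot {2 ℕ.* n} 4 i)
      s = proj₂ (remQuot {2 ℕ.* n} 4 i)

    finiteGroup : FiniteGroup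
    finiteGroup = record
      { group       = group
      ; order       = 2 ℕ.* n ℕ.* 4
      ; enumeration = record
        { to        = fromFin
        ; from      = toFin
        ; to-cong   = λ { refl → ≈-refl }
        ; from-cong = toFin-cong
        ; inverse   = (λ { {w} refl → fromFin-toFin w })
                    , (λ {i} w≈fromFin → trans (toFin-cong w≈fromFin) (toFin-fromFin i))
        }
      }

    _≈?_ : Decidable _≈_
    u ≈? v = map′
      (λ eq → T.trans (T.sym (fromFin-toFin u)) (T.trans (T.reflexive (cong fromFin eq)) (fromFin-toFin v)))
      toFin-cong (toFin u Fin.≟ toFin v)

    S? : Unary.Decidable S
    S? x = map′
      (λ { (inj₁ s≢0) → ≢0⇒∈S x s≢0
         ; (inj₂ (p , x≉ε)) → inj₁ (inj₁ (⇒∈⟨a²⟩ x p , x≉ε)) })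
      (λ { (inj₁ (inj₁ (p , x≉ε))) → inj₂ (∈⟨a²⟩⇒ p , x≉ε)
         ; (inj₁ (inj₂ p)) → inj₁ (∈⟨a⟩▸⇒≢0 (λ ()) p)
         ; (inj₂ (inj₁ p)) → inj₁ (∈⟨a⟩▸⇒≢0 (λ ()) p)
         ; (inj₂ (inj₂ p)) → inj₁ (∈⟨a⟩▸⇒≢0 (λ ()) p) })
      (¬? (s Fin.≟ 0F) ⊎-dec ((+ 2 ℤ.∣? r ×-dec s Fin.≟ 0F) ×-dec ¬? (x ≈? ε)))
      where
      r = proj₁ (coordinates x)
      s = proj₂ (coordinates x)

    connectionSet : ConnectionSet group
    connectionSet = record
      { S         = S
      ; S?        = S?
      ; S-resp-≈  = S-resp
      ; nonempty  = b , ≢0⇒∈S b (λ ())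
      ; ε∉S       = λ
        { (inj₁ (inj₁ (_ , ε≉ε))) → ε≉ε ≈-refl
        ; (inj₁ (inj₂ p)) → ∈⟨a⟩▸⇒≢0 (λ ()) p refl
        ; (inj₂ (inj₁ p)) → ∈⟨a⟩▸⇒≢0 (λ ()) p refl
        ; (inj₂ (inj₂ p)) → ∈⟨a⟩▸⇒≢0 (λ ()) p refl
        }
      ; ⁻¹-closed = closed
      }
      where
      S-resp : S Respects _≈_
      S-resp x≈y (inj₁ (inj₁ ((k , x≈) , x≉ε)))  =
        inj₁ (inj₁ ((k , T.trans (T.sym x≈y) x≈) , λ y≈ε → x≉ε (T.trans x≈y y≈ε)))
      S-resp x≈y (inj₁ (inj₂ (h , h∈ , x≈))) = inj₁ (inj₂ (h , h∈ , T.trans (T.sym x≈y) x≈))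
      S-resp x≈y (inj₂ (inj₁ (h , h∈ , x≈))) = inj₂ (inj₁ (h , h∈ , T.trans (T.sym x≈y) x≈))
      S-resp x≈y (inj₂ (inj₂ (h , h∈ , x≈))) = inj₂ (inj₂ (h , h∈ , T.trans (T.sym x≈y) x≈))

      ∈▸⇒⁻¹∈S : ∀ {x y} → ¬ proj₂ (coordinates y) ≡ 0F → x ∈ ⟨ a ⟩ ▸ y → x ⁻¹ ∈ S
      ∈▸⇒⁻¹∈S {x} y≢0 p = ≢0⇒∈S (x ⁻¹) (λ s≡0 → ∈⟨a⟩▸⇒≢0 y≢0 p (≡0-⁻¹ x s≡0))

      closed : ∀ {x} → x ∈ S → x ⁻¹ ∈ S
      closed {x} (inj₁ (inj₁ ((k , x≈) , x≉ε))) = inj₁ (inj₁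
        ( (ℤ.- k , T.trans (⁻¹-cong x≈) (T.sym (^-neg (a ^ (+ 2)) k)))
        , (λ x⁻¹≈ε → x≉ε (T.trans (T.sym (GroupProperties.⁻¹-involutive group x))
            (T.trans (⁻¹-cong x⁻¹≈ε) (GroupProperties.ε⁻¹≈ε group))))))
      closed (inj₁ (inj₂ p)) = ∈▸⇒⁻¹∈S (λ ()) p
      closed (inj₂ (inj₁ p)) = ∈▸⇒⁻¹∈S (λ ()) p
      closed (inj₂ (inj₂ p)) = ∈▸⇒⁻¹∈S (λ ()) p

{-# OPTIONS --safe #-}

-- Writing the vertex a²ᵏ⁺ᵖbˢ as (s , p , k), two vertices are non-adjacent
-- exactly when they are equal or lie in the opposite cells (s , 0) and (s , 1).
-- So if T(s , p) is the sum of v over a cell and σ the sum of all T(s , p), then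
-- v is an eigenvector for θ iff, with μ = θ + 1,
-- μ v(s , p , k) + T(s , 1 - p) = σ for all s, p and k.  Summing this over cells
-- gives (μ - 7n) σ = 0.  If σ = 0, it gives (μ + n) (T(s , 0) + T(s , 1)) = 0; if
-- these sums vanish too, (μ - n) T(s , p) = 0; and if all T vanish, μ v = 0.
-- Hence μ is one of 7n, -n, n and 0.

module Submission where

open import Defs
open import Algebra.Apartness.Bundles using (HeytingField; HeytingCommutativeRing)
import Algebra.Apartness.Properties.HeytingCommutativeRing as ApartnessProperties
open import Algebra.Bundles using (CommutativeRing; Group)
import Algebra.Properties.AbelianGroup as AbelianGroupProperties
import Algebra.Properties.Group as GroupProperties
import Algebra.Properties.Ring as RingProperties
import Algebra.Properties.Semiring.Mult as Mult
import Algebra.Properties.Semiring.Sum as Sum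
import Algebra.Solver.Ring.NaturalCoefficients.Default as RingSolver
open import Data.Bool.Base using (if_then_else_)
open import Data.Fin.Base using (Fin; zero; suc; cast; combine; _↑ˡ_; _↑ʳ_; toℕ; remQuot; opposite)
open import Data.Fin.Patterns using (0F; 1F; 2F; 3F)
import Data.Fin.Properties as Fin
open import Data.Integer.Base as ℤ using (ℤ; +_; -[1+_])
open import Data.Integer.Divisibility.Signed as ℤ using (divides)
import Data.Integer.Properties as ℤ
open import Data.Integer.Tactic.RingSolver using (solve-∀)
open import Data.List.Base using (List; _∷_; [])
open import Data.List.Relation.Unary.All using (All; _∷_; [])
open import Data.List.Relation.Unary.AllPairs using (AllPairs; _∷_; [])
open import Data.List.Relation.Unary.Any using (Any; here; there)
open import Data.Nat.Base as ℕ using (ℕ; zero; suc; NonZero)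
import Data.Nat.Divisibility as ℕ
import Data.Nat.Properties as ℕ
import Data.Nat.Tactic.RingSolver as ℕ-RingSolver
open import Data.Product.Base using (_×_; _,_; proj₁; proj₂; ∃; swap)
open import Data.Sum.Base using (_⊎_; inj₁; inj₂)
open import Data.Vec.Functional using (Vector)
open import Function.Base using (_∘_)
open import Relation.Binary.PropositionalEquality.Core as ≡ using (_≡_; _≢_)
import Relation.Binary.Reasoning.Setoid as SetoidReasoning
open import Relation.Nullary using (¬_; Dec; yes; no; does)
open import Relation.Nullary.Decidable using (dec-true; dec-false; from-yes; _×-dec_; ¬?)
open import Relation.Nullary.Negation using (contradiction)
open import Relation.Unary using (_∈_)

-- The adjacency pattern: everything outside ⟨a⟩ lies in S, so different cosets of ⟨a⟩ are
-- completely joined. Inside one coset x y⁻¹ is a power of a, and it lies in S only if it is a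
-- nontrivial even power; parity of the exponent makes sense because it is taken modulo 2n. The
-- complement is thus four disjoint copies of K_{n,n}, and the adjacency matrix is J - I - P, where
-- P joins each cell to its opposite.
--
-- The chain of vanishing sums also yields the multiplicities. The total σ contributes 1; coset sums
-- with total zero contribute 3; cell sums opposite in sign within each coset contribute 4; vectors
-- with zero sum on each of the 8 cells contribute 8(n - 1).
--
-- Equality in a Heyting field need not be decidable, so no rank argument or case split on scalars
-- is available. Each dimension comes from an explicit basis with pivot coordinates: the basis is
-- the identity matrix there, and an eigenvector vanishing there is zero. The latter must be shown
-- for each μ separately, since the chain stops at the one step where μ is not apart from the
-- relevant scalar.

module Field {c ℓ₁ ℓ₂} (K : HeytingField c ℓ₁ ℓ₂) where
  open HeytingField K public hiding (zero)
  open CommutativeRing (HeytingCommutativeRing.commutativeRing heytingCommutativeRing) public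
    using (ring; semiring; commutativeSemiring; +-abelianGroup)
  open ApartnessProperties heytingCommutativeRing public
  open RingProperties ring public
    using (-‿distribˡ-*; -‿distribʳ-*; [y-z]x≈yx-zx; -0#≈0#)
  open AbelianGroupProperties +-abelianGroup public
    using ()
    renaming ( ⁻¹-∙-comm to -‿+-comm; ⁻¹-involutive to -‿involutive; x≈y⇒x∙y⁻¹≈ε to x≈y⇒x-y≈0
             ; inverseˡ-unique to -‿uniqueˡ; ∙-cancelʳ to +-cancelʳ )
  open Mult semiring public renaming (_×_ to _×ᶠ_)
  open Sum semiring public
  open RingSolver commutativeSemiring public using (solve; _:=_; _:+_; _:*_; con)
  module ≈-Reasoning = SetoidReasoning setoid
  open ≈-Reasoning

  -- Apartness and cancellation in a Heyting field.

  #-resp-difference : ∀ {x y z w} → x - y ≈ z - w → x # y → z # w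
  #-resp-difference eq x#y with u , u[x-y]≈1 , _ ← #⇒invertible x#y =
    invertibleˡ⇒# (u , trans (*-congˡ (sym eq)) u[x-y]≈1)

  -- Apartness means that `x - y` is invertible. Every elimination in the eigenvalue analysis ends
  -- in this shape, with two scalars that act alike on a sum of coordinates.
  *-cancel-# : ∀ {x y z} → x # y → x * z ≈ y * z → z ≈ 0#
  *-cancel-# {x} {y} {z} x#y xz≈yz with u , u[x-y]≈1 , _ ← #⇒invertible x#y = begin
    z                      ≈⟨ *-identityˡ z ⟨
    1# * z                 ≈⟨ *-congʳ u[x-y]≈1 ⟨
    u * (x - y) * z        ≈⟨ *-assoc u (x - y) z ⟩
    u * ((x - y) * z)      ≈⟨ *-congˡ ([y-z]x≈yx-zx z x y) ⟩
    u * (x * z - y * z)    ≈⟨ *-congˡ (x≈y⇒x-y≈0 xz≈yz) ⟩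
    u * 0#                 ≈⟨ zeroʳ u ⟩
    0#                     ∎

  *-cancel-0 : ∀ {x z} → x # 0# → x * z ≈ 0# → z ≈ 0#
  *-cancel-0 x#0 xz≈0 = *-cancel-# x#0 (trans xz≈0 (sym (zeroˡ _)))

  -- Cotransitivity makes θ apart from all but one of pairwise apart
  -- elements; tightness then identifies it with the remaining one.
  any-≈ : ∀ {a} {A : Set a} (f : A → Carrier) {xs : List A} θ →
          AllPairs (λ x y → f x # f y) xs → ¬ All (λ x → θ # f x) xs → Any (λ x → θ ≈ f x) xs
  any-≈ f θ []         ¬all = contradiction [] ¬all
  any-≈ f {x ∷ xs} θ (x#xs ∷ xs#) ¬all with split x#xs
    where
    split : ∀ {ys} → All (λ y → f x # f y) ys → θ # f x ⊎ All (λ y → θ # f y) ys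
    split []           = inj₂ []
    split (x#y ∷ x#ys) with #-cotrans x#y θ | split x#ys
    ... | inj₁ x#θ | _         = inj₁ (#-sym x#θ)
    ... | inj₂ θ#y | inj₁ θ#x  = inj₁ θ#x
    ... | inj₂ θ#y | inj₂ θ#ys = inj₂ (θ#y ∷ θ#ys)
  ... | inj₁ θ#x  = there (any-≈ f θ xs# (λ θ#xs → ¬all (θ#x ∷ θ#xs)))
  ... | inj₂ θ#xs = here (proj₁ (tight _ _) (λ θ#x → ¬all (θ#x ∷ θ#xs)))

  -- The integers inside the field.

  ℤ→ : ℤ → Carrier
  ℤ→ = fromℤ K

  ℤ→-⊖ : ∀ m n → ℤ→ (m ℤ.⊖ n) ≈ m ×ᶠ 1# - n ×ᶠ 1#
  ℤ→-⊖ m       zero    = sym (x-0≈x _)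
  ℤ→-⊖ zero    (suc n) = sym (+-identityˡ _)
  ℤ→-⊖ (suc m) (suc n) = begin
    ℤ→ (suc m ℤ.⊖ suc n)                   ≡⟨ ≡.cong ℤ→ (ℤ.[1+m]⊖[1+n]≡m⊖n m n) ⟩
    ℤ→ (m ℤ.⊖ n)                           ≈⟨ ℤ→-⊖ m n ⟩
    x - y                                  ≈⟨ +-congʳ (+-identityˡ x) ⟨
    0# + x - y                             ≈⟨ +-congʳ (+-congʳ (-‿inverseʳ 1#)) ⟨
    1# - 1# + x - y                        ≈⟨ solve 4 (λ a b c d → a :+ b :+ c :+ d := a :+ c :+ (b :+ d)) refl 1# (- 1#) x (- y) ⟩
    1# + x + (- 1# - y)                    ≈⟨ +-congˡ (-‿+-comm 1# y) ⟩
    (1# + x) - (1# + y)                    ∎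
    where
    x = m ×ᶠ 1#
    y = n ×ᶠ 1#

  ℤ→-+ : ∀ i j → ℤ→ (i ℤ.+ j) ≈ ℤ→ i + ℤ→ j
  ℤ→-+ (+ m)    (+ n)    = ×-homo-+ 1# m n
  ℤ→-+ (+ m)    -[1+ n ] = ℤ→-⊖ m (suc n)
  ℤ→-+ -[1+ m ] (+ n)    = trans (ℤ→-⊖ n (suc m)) (+-comm _ _)
  ℤ→-+ -[1+ m ] -[1+ n ] = begin
    - ((2 ℕ.+ (m ℕ.+ n)) ×ᶠ 1#)            ≡⟨ ≡.cong (λ k → - (suc k ×ᶠ 1#)) (ℕ.+-suc m n) ⟨
    - ((suc m ℕ.+ suc n) ×ᶠ 1#)            ≈⟨ -‿cong (×-homo-+ 1# (suc m) (suc n)) ⟩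
    - (suc m ×ᶠ 1# + suc n ×ᶠ 1#)          ≈⟨ -‿+-comm _ _ ⟨
    - (suc m ×ᶠ 1#) - suc n ×ᶠ 1#          ∎

  ℤ→-neg : ∀ i → ℤ→ (ℤ.- i) ≈ - ℤ→ i
  ℤ→-neg (+ zero)  = sym -0#≈0#
  ℤ→-neg (+ suc n) = refl
  ℤ→-neg -[1+ n ]  = sym (-‿involutive _)

  ℤ→-pred : ∀ i → ℤ→ (i ℤ.- + 1) ≈ ℤ→ i - 1#
  ℤ→-pred i = trans (ℤ→-+ i -[1+ 0 ]) (+-congˡ (-‿cong (+-identityʳ 1#)))

  -- Only the difference of the two images matters, and it is the image of the nonzero integer i -
  -- j. All apartness between eigenvalues is thereby reduced to inequality of integers.
  ℤ→-injective-# : CharacteristicZero K → ∀ {i j} → i ≢ j → ℤ→ i # ℤ→ j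
  ℤ→-injective-# char {i} {j} i≢j = #-resp-difference difference (≢0⇒#0 (i≢j ∘ ℤ.i-j≡0⇒i≡j i j))
    where
    ≢0⇒#0 : ∀ {k} → k ≢ + 0 → ℤ→ k # 0#
    ≢0⇒#0 {+ zero}   k≢0 = contradiction ≡.refl k≢0
    ≢0⇒#0 {+ suc n}  k≢0 = char (suc n)
    ≢0⇒#0 { -[1+ n ]} k≢0 =
      #-resp-difference (trans (+-identityˡ _) (sym (x-0≈x _))) (#-sym (char (suc n)))
    difference : ℤ→ (i ℤ.- j) - 0# ≈ ℤ→ i - ℤ→ j
    difference = trans (x-0≈x _) (trans (ℤ→-+ i (ℤ.- j)) (+-congˡ (ℤ→-neg j)))

  -- Kronecker deltas and finite sums.

  iverson : ∀ {p} {P : Set p} → Dec P → Carrier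
  iverson P? = if does P? then 1# else 0#

  iverson-true : ∀ {p} {P : Set p} (P? : Dec P) → P → iverson P? ≡ 1#
  iverson-true P? p = ≡.cong (if_then 1# else 0#) (dec-true P? p)

  iverson-false : ∀ {p} {P : Set p} (P? : Dec P) → ¬ P → iverson P? ≡ 0#
  iverson-false P? ¬p = ≡.cong (if_then 1# else 0#) (dec-false P? ¬p)

  δ : ∀ {n} → Fin n → Fin n → Carrier
  δ i j = iverson (i Fin.≟ j)

  δ-diagonal : ∀ {n} {i j : Fin n} → i ≡ j → δ i j ≈ 1#
  δ-diagonal {i = i} {j} i≡j = reflexive (iverson-true (i Fin.≟ j) i≡j)

  δ-offDiagonal : ∀ {n} {i j : Fin n} → i ≢ j → δ i j ≈ 0#
  δ-offDiagonal {i = i} {j} i≢j = reflexive (iverson-false (i Fin.≟ j) i≢j)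

  δ-sym : ∀ {n} (i j : Fin n) → δ i j ≈ δ j i
  δ-sym i j with i Fin.≟ j
  ... | yes i≡j = sym (δ-diagonal (≡.sym i≡j))
  ... | no  i≢j = sym (δ-offDiagonal (i≢j ∘ ≡.sym))

  sum-zero : ∀ {n} {f : Vector Carrier n} → (∀ i → f i ≈ 0#) → sum f ≈ 0#
  sum-zero {n} f≈0 = trans (sum-cong-≋ f≈0) (sum-replicate-zero n)

  sum-δ : ∀ {n} (i : Fin n) (f : Vector Carrier n) → sum (λ j → δ i j * f j) ≈ f i
  sum-δ {suc n} zero f = begin
    1# * f zero + sum (λ j → 0# * f (suc j))  ≈⟨ +-cong (*-identityˡ _) (sum-zero {n} (λ j → zeroˡ _)) ⟩
    f zero + 0#                               ≈⟨ +-identityʳ _ ⟩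
    f zero                                    ∎
  sum-δ (suc i) f = begin
    0# * f zero + sum (λ j → δ i j * f (suc j))  ≈⟨ +-cong (zeroˡ _) (sum-δ i (f ∘ suc)) ⟩
    0# + f (suc i)                               ≈⟨ +-identityˡ _ ⟩
    f (suc i)                                    ∎

  δ-combine : ∀ {m n} (i i′ : Fin m) (j j′ : Fin n) → δ (combine i j) (combine i′ j′) ≈ δ i i′ * δ j j′
  δ-combine i i′ j j′ with i Fin.≟ i′ | j Fin.≟ j′
  ... | yes i≡i′ | yes j≡j′ = trans (δ-diagonal (≡.cong₂ combine i≡i′ j≡j′)) (sym (*-identityˡ 1#))
  ... | no  i≢i′ | _        = trans (δ-offDiagonal (i≢i′ ∘ Fin.combine-injectiveˡ i j i′ j′)) (sym (zeroˡ _))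
  ... | yes _    | no j≢j′  = trans (δ-offDiagonal (j≢j′ ∘ Fin.combine-injectiveʳ i j i′ j′)) (sym (zeroʳ _))

  -- Differences of two unit vectors are the building blocks of the bases of zero-sum vectors, over
  -- the cosets for μ = -n and inside a cell for μ = 0.
  sum-δ-δ : ∀ {n} (i j : Fin n) → sum (λ k → δ i k - δ j k) ≈ 0#
  sum-δ-δ i j = begin
    sum (λ k → δ i k - δ j k)                  ≈⟨ sum-cong-≋ (λ k → sym (+-cong (*-identityʳ (δ i k)) (*-identityʳ _))) ⟩
    sum (λ k → δ i k * 1# + - δ j k * 1#)      ≈⟨ ∑-distrib-+ (λ k → δ i k * 1#) (λ k → - δ j k * 1#) ⟩
    sum (λ k → δ i k * 1#) + sum (λ k → - δ j k * 1#)
      ≈⟨ +-cong (sum-δ i (λ _ → 1#))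
           (sum-cong-≋ (λ k → trans (sym (-‿distribˡ-* (δ j k) 1#)) (-‿distribʳ-* (δ j k) 1#))) ⟩
    1# + sum (λ k → δ j k * - 1#)              ≈⟨ +-congˡ (sum-δ j (λ _ → - 1#)) ⟩
    1# - 1#                                    ≈⟨ -‿inverseʳ 1# ⟩
    0#                                         ∎

  sum-+ : ∀ m {n} (f : Vector Carrier (m ℕ.+ n)) → sum f ≈ sum (λ i → f (i ↑ˡ n)) + sum (λ i → f (m ↑ʳ i))
  sum-+ zero    f = sym (+-identityˡ _)
  sum-+ (suc m) f = trans (+-congˡ (sum-+ m (f ∘ suc))) (sym (+-assoc _ _ _))

  sum-combine : ∀ {m n} (f : Vector Carrier (m ℕ.* n)) → sum f ≈ sum (λ i → sum (λ j → f (combine {m} {n} i j)))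
  sum-combine {zero}      f = refl
  sum-combine {suc m} {n} f = trans (sum-+ n f) (+-congˡ (sum-combine {m} (f ∘ (n ↑ʳ_))))

  sum-cast : ∀ {m n} (eq : m ≡ n) (f : Vector Carrier n) → sum f ≡ sum (f ∘ cast eq)
  sum-cast ≡.refl f = sum-cong-≗ (λ i → ≡.cong f (≡.sym (Fin.cast-is-id ≡.refl i)))

  -- Eigenspaces and their dimension.

  module _ {n} (A : Matrix K {n}) where

    ·-+ : ∀ x y i → (_·_ K A (λ j → x j + y j)) i ≈ (_·_ K A x) i + (_·_ K A y) i
    ·-+ x y i = trans (sum-cong-≋ (λ j → distribˡ (A i j) (x j) (y j))) (∑-distrib-+ (λ j → A i j * x j) (λ j → A i j * y j))

    ·-linearCombination : ∀ {m} (d : Vector Carrier m) v i →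
      (_·_ K A (linearCombination K d v)) i ≈ linearCombination K d (λ j → _·_ K A (v j)) i
    ·-linearCombination d v i = begin
      sum (λ k → A i k * sum (λ j → d j * v j k))      ≈⟨ sum-cong-≋ (λ k → *-distribˡ-sum (A i k) (λ j → d j * v j k)) ⟩
      sum (λ k → sum (λ j → A i k * (d j * v j k)))    ≈⟨ ∑-comm (λ k j → A i k * (d j * v j k)) ⟩
      sum (λ j → sum (λ k → A i k * (d j * v j k)))    ≈⟨ sum-cong-≋ (λ j → sum-cong-≋ (λ k → exchange (A i k) (d j) (v j k))) ⟩
      sum (λ j → sum (λ k → d j * (A i k * v j k)))    ≈⟨ sum-cong-≋ (λ j → *-distribˡ-sum (d j) (λ k → A i k * v j k)) ⟨
      sum (λ j → d j * sum (λ k → A i k * v j k))      ∎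
      where
      exchange : ∀ x y z → x * (y * z) ≈ y * (x * z)
      exchange = solve 3 (λ x y z → x :* (y :* z) := y :* (x :* z)) refl

    module _ (θ : Carrier) where

      +-eigenspace : ∀ {x y} → x ∈ Eigenspace K A θ → y ∈ Eigenspace K A θ → (λ i → x i + y i) ∈ Eigenspace K A θ
      +-eigenspace {x} {y} x∈ y∈ i = begin
        _·_ K A (λ j → x j + y j) i     ≈⟨ ·-+ x y i ⟩
        _·_ K A x i + _·_ K A y i       ≈⟨ +-cong (x∈ i) (y∈ i) ⟩
        θ * x i + θ * y i               ≈⟨ distribˡ θ (x i) (y i) ⟨
        θ * (x i + y i)                 ∎

      linearCombination-eigenspace : ∀ {m} (d : Vector Carrier m) {v} → (∀ j → v j ∈ Eigenspace K A θ) →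
        linearCombination K d v ∈ Eigenspace K A θ
      linearCombination-eigenspace d {v} v∈ i = begin
        _·_ K A (linearCombination K d v) i        ≈⟨ ·-linearCombination d v i ⟩
        sum (λ j → d j * _·_ K A (v j) i)          ≈⟨ sum-cong-≋ (λ j → *-congˡ (v∈ j i)) ⟩
        sum (λ j → d j * (θ * v j i))              ≈⟨ sum-cong-≋ (λ j → exchange (d j) (v j i)) ⟩
        sum (λ j → θ * (d j * v j i))              ≈⟨ *-distribˡ-sum θ (λ j → d j * v j i) ⟨
        θ * linearCombination K d v i              ∎
        where
        exchange : ∀ y z → y * (θ * z) ≈ θ * (y * z)
        exchange y z = solve 3 (λ x y z → y :* (x :* z) := x :* (y :* z)) refl θ y z

      -- The coordinates of w are read off at the pivots, because the
      -- difference of w and that combination vanishes at all of them.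
      pivots⇒dimension : ∀ {m} (v : Vector (Vector Carrier n) m) (pivot : Fin m → Fin n) →
        (∀ j → v j ∈ Eigenspace K A θ) →
        (∀ i j → v j (pivot i) ≈ δ j i) →
        (∀ {w} → w ∈ Eigenspace K A θ → (∀ j → w (pivot j) ≈ 0#) → ∀ i → w i ≈ 0#) →
        HasDimension K (Eigenspace K A θ) m
      pivots⇒dimension v pivot v∈ v-pivot determined = v , record
        { members     = v∈
        ; independent = λ d combination≈0 j → trans (sym (combination-pivot d j)) (combination≈0 (pivot j))
        ; spanning    = λ {w} w∈ → w ∘ pivot , λ i → spans w∈ i
        }
        where
        combination-pivot : ∀ d j → linearCombination K d v (pivot j) ≈ d j
        combination-pivot d j = trans
          (sum-cong-≋ (λ i → trans (*-congˡ (trans (v-pivot j i) (δ-sym i j))) (*-comm _ _))) (sum-δ j d)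

        spans : ∀ {w} → w ∈ Eigenspace K A θ → ∀ i → w i ≈ linearCombination K (w ∘ pivot) v i
        spans {w} w∈ i = begin
          w i                     ≈⟨ +-identityʳ _ ⟨
          w i + 0#                ≈⟨ +-congˡ cancel ⟨
          w i + (L⁻ i + L i)      ≈⟨ +-assoc _ _ _ ⟨
          w i + L⁻ i + L i        ≈⟨ +-congʳ (determined (+-eigenspace w∈ (linearCombination-eigenspace _ v∈)) vanishes i) ⟩
          0# + L i                ≈⟨ +-identityˡ _ ⟩
          L i                     ∎
          where
          L L⁻ : Vector Carrier n
          L  = linearCombination K (w ∘ pivot) v
          L⁻ = linearCombination K (λ j → - w (pivot j)) v
          cancel : L⁻ i + L i ≈ 0#
          cancel = trans (sym (∑-distrib-+ (λ j → - w (pivot j) * v j i) (λ j → w (pivot j) * v j i)))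
            (sum-zero (λ j → trans (sym (distribʳ (v j i) (- w (pivot j)) (w (pivot j))))
              (trans (*-congʳ (-‿inverseˡ _)) (zeroˡ _))))
          vanishes : ∀ j → w (pivot j) + L⁻ (pivot j) ≈ 0#
          vanishes j = trans (+-congˡ (combination-pivot _ j)) (-‿inverseʳ _)

-- The division of the vertices into eight cells.

module Cells (n : ℕ) where

  -- The position of the vertex a²ᵏ⁺ᵖ bˢ.
  position : Fin 4 → Fin 2 → Fin n → Fin (2 ℕ.* n ℕ.* 4)
  position s p k = combine (cast (ℕ.*-comm n 2) (combine k p)) s

  split : Fin (2 ℕ.* n ℕ.* 4) → Fin 4 × Fin 2 × Fin n
  split i = let r , s = remQuot {2 ℕ.* n} 4 i
                k , p = remQuot {n} 2 (cast (ℕ.*-comm 2 n) r)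
            in s , p , k

  split-position : ∀ s p k → split (position s p k) ≡ (s , p , k)
  split-position s p k = ≡.trans
    (≡.cong (λ (r , s) → s , swap (remQuot {n} 2 (cast (ℕ.*-comm 2 n) r)))
      (Fin.remQuot-combine (cast (ℕ.*-comm n 2) (combine k p)) s))
    (≡.cong (λ x → s , swap x) (≡.trans
      (≡.cong (remQuot {n} 2) (Fin.cast-involutive (ℕ.*-comm 2 n) (ℕ.*-comm n 2) (combine k p)))
      (Fin.remQuot-combine k p)))

  position-split : ∀ i → let s , p , k = split i in position s p k ≡ i
  position-split i = let r , s = remQuot {2 ℕ.* n} 4 i in ≡.trans
    (≡.cong (λ x → combine x s) (≡.trans
      (≡.cong (cast (ℕ.*-comm n 2)) (Fin.combine-remQuot {n} 2 (cast (ℕ.*-comm 2 n) r)))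
      (Fin.cast-involutive (ℕ.*-comm n 2) (ℕ.*-comm 2 n) r)))
    (Fin.combine-remQuot {2 ℕ.* n} 4 i)

  position-elim : ∀ {ℓ} (P : Fin (2 ℕ.* n ℕ.* 4) → Set ℓ) → (∀ s p k → P (position s p k)) → ∀ i → P i
  position-elim P f i = ≡.subst P (position-split i) (f _ _ _)

  module _ {c ℓ₁ ℓ₂} (K : HeytingField c ℓ₁ ℓ₂) where
    open Field K

    -- The enumeration runs through s fastest, then p, then k, the reverse of the nesting on the
    -- right; hence the two exchanges of summation.
    sum-position : ∀ f → sum f ≈ sum (λ s → sum (λ p → sum (λ k → f (position s p k))))
    sum-position f = begin
      sum f                                                     ≈⟨ sum-combine {2 ℕ.* n} f ⟩
      sum (λ r → sum (λ s → g r s))                             ≈⟨ ∑-comm g ⟩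
      sum (λ s → sum (λ r → g r s))                             ≈⟨ sum-cong-≋ {4} (λ s → column s) ⟩
      sum (λ s → sum (λ p → sum (λ k → f (position s p k))))    ∎
      where
      open ≈-Reasoning
      g : Fin (2 ℕ.* n) → Fin 4 → Carrier
      g r s = f (combine r s)
      column : ∀ s → sum (λ r → g r s) ≈ sum (λ p → sum (λ k → f (position s p k)))
      column s = begin
        sum (λ r → g r s)                                 ≡⟨ sum-cast (ℕ.*-comm n 2) (λ r → g r s) ⟩
        sum (λ r → g (cast (ℕ.*-comm n 2) r) s)           ≈⟨ sum-combine {n} (λ r → g (cast (ℕ.*-comm n 2) r) s) ⟩
        sum (λ k → sum (λ p → f (position s p k)))        ≈⟨ ∑-comm (λ k p → f (position s p k)) ⟩
        sum (λ p → sum (λ k → f (position s p k)))        ∎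

-- Adjacency and connectedness in cell coordinates.

opposite≢ : ∀ (p : Fin 2) → opposite p ≢ p
opposite≢ 0F ()
opposite≢ 1F ()

≢⇒opposite : ∀ (p p′ : Fin 2) → p ≢ p′ → opposite p ≡ p′
≢⇒opposite 0F 0F p≢p′ = contradiction ≡.refl p≢p′
≢⇒opposite 0F 1F _    = ≡.refl
≢⇒opposite 1F 0F _    = ≡.refl
≢⇒opposite 1F 1F p≢p′ = contradiction ≡.refl p≢p′

-- Supplies the middle vertex of a walk of length two: it lies in a coset of ⟨a⟩ that contains
-- neither endpoint.
anotherThan : ∀ (s s′ : Fin 4) → ∃ λ t → s ≢ t × t ≢ s′
anotherThan = from-yes (Fin.all? {4} λ s → Fin.all? {4} λ s′ → Fin.any? λ t → ¬? (s Fin.≟ t) ×-dec ¬? (t Fin.≟ s′))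

module Adjacency (n : ℕ) .{{_ : NonZero n}} where
  open T₈ₙ n
  open Cells n
  open PowerProperties group
  open GroupProperties group using (//-rightDividesˡ; ⁻¹-anti-homo-∙; \\-leftDividesˡ; x∙y⁻¹≈ε⇒x≈y)
  open ConnectionSet connectionSet using (S-resp-≈)
  private
    module T = Group group
  open SetoidReasoning T.setoid hiding (stop)

  -- Otherwise x y⁻¹ would have b-exponent 0 and be a power of a, so x would lie in ⟨a⟩y and have
  -- the b-exponent of y.
  ≢⇒//∈S : ∀ x y → proj₂ (coordinates x) ≢ proj₂ (coordinates y) → x ∙ y ⁻¹ ∈ S
  ≢⇒//∈S x y s≢s′ = ≢0⇒∈S (x ∙ y ⁻¹) λ s≡0 → s≢s′ (∈⟨a⟩▸⇒ {x} {y} (a ^ r , (r , ≈-refl) , (begin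
    x                      ≈⟨ //-rightDividesˡ y x ⟨
    x ∙ y ⁻¹ ∙ y           ≈⟨ T.∙-congʳ (normalWord-coordinates (x ∙ y ⁻¹)) ⟩
    normalWord (coordinates (x ∙ y ⁻¹)) ∙ y ≡⟨ ≡.cong (λ s → normalWord (r , s) ∙ y) s≡0 ⟩
    a ^ r ∙ ε ∙ y          ≈⟨ T.∙-congʳ (identityʳ _) ⟩
    a ^ r ∙ y              ∎)))
    where r = proj₁ (coordinates (x ∙ y ⁻¹))

  normalWord-// : ∀ r r′ s → normalWord (r , s) ∙ normalWord (r′ , s) ⁻¹ ≈ a ^ (r ℤ.- r′)
  normalWord-// r r′ s = begin
    a ^ r ∙ B ∙ (a ^ r′ ∙ B) ⁻¹         ≈⟨ T.∙-congˡ (⁻¹-anti-homo-∙ _ _) ⟩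
    a ^ r ∙ B ∙ (B ⁻¹ ∙ (a ^ r′) ⁻¹)    ≈⟨ assoc _ _ _ ⟩
    a ^ r ∙ (B ∙ (B ⁻¹ ∙ (a ^ r′) ⁻¹))  ≈⟨ T.∙-congˡ (\\-leftDividesˡ B _) ⟩
    a ^ r ∙ (a ^ r′) ⁻¹                 ≈⟨ T.∙-congˡ (^-neg a r′) ⟨
    a ^ r ∙ a ^ (ℤ.- r′)                ≈⟨ ^-+ a r (ℤ.- r′) ⟨
    a ^ (r ℤ.- r′)                      ∎
    where B = b ^ (+ toℕ s)

  ∣⇒normalWord-//∈S : ∀ r r′ s → + 2 ℤ.∣ r ℤ.- r′ → ¬ normalWord (r , s) ≈ normalWord (r′ , s) →
    normalWord (r , s) ∙ normalWord (r′ , s) ⁻¹ ∈ S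
  ∣⇒normalWord-//∈S r r′ s (divides q r-r′≡q2) x≉y = inj₁ (inj₁ ((q , (begin
    normalWord (r , s) ∙ normalWord (r′ , s) ⁻¹  ≈⟨ normalWord-// r r′ s ⟩
    a ^ (r ℤ.- r′)                               ≡⟨ ≡.cong (a ^_) r-r′≡q2 ⟩
    a ^ (q ℤ.* + 2)                              ≈⟨ ^-* a (+ 2) q ⟩
    (a ^ (+ 2)) ^ q                              ∎)) , λ eq → x≉y (x∙y⁻¹≈ε⇒x≈y _ _ eq)))

  -- The other three constituents of S are cosets with b-exponent 2, 1 or 3, whereas a power of a
  -- has b-exponent 0.
  a^∈S⇒∣ : ∀ r → a ^ r ∈ S → + 2 ℤ.∣ r
  a^∈S⇒∣ r = λ
    { (inj₁ (inj₁ (a^r∈ , _))) → ≡.subst (+ 2 ℤ.∣_)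
        (≡.trans (≡.cong proj₁ (act-a^ r (+ 0) 0F)) (ℤ.+-identityʳ r)) (proj₁ (∈⟨a²⟩⇒ a^r∈))
    ; (inj₁ (inj₂ p)) → contradiction s≡0 (∈⟨a⟩▸⇒≢0 (λ ()) p)
    ; (inj₂ (inj₁ p)) → contradiction s≡0 (∈⟨a⟩▸⇒≢0 (λ ()) p)
    ; (inj₂ (inj₂ p)) → contradiction s≡0 (∈⟨a⟩▸⇒≢0 (λ ()) p)
    }
    where
    s≡0 : proj₂ (coordinates (a ^ r)) ≡ 0F
    s≡0 = ≡.cong proj₂ (act-a^ r (+ 0) 0F)

  open FiniteGraph (Cay (T₈ₙ.finiteGroup n) (T₈ₙ.connectionSet n)) using (vertex; _~_; _~?_; ~-irrefl)

  connected : Connected (Cay (T₈ₙ.finiteGroup n) (T₈ₙ.connectionSet n))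
  connected x y with t , s≢t , t≢s′ ← anotherThan (proj₂ (coordinates x)) (proj₂ (coordinates y)) =
    step {y = z} (≢⇒//∈S x z (λ eq → s≢t (≡.trans eq z≡t)))
      (step (≢⇒//∈S z y (λ eq → t≢s′ (≡.trans (≡.sym z≡t) eq))) (stop ≈-refl))
    where
    z = normalWord (+ 0 , t)
    z≡t = ≡.cong proj₂ (coordinates-normalWord (+ 0 , t))

  exponent : Fin 2 → Fin n → ℤ
  exponent p k = + (2 ℕ.* toℕ k ℕ.+ toℕ p)

  vertex-position : ∀ s p k → vertex (position s p k) ≡ normalWord (exponent p k , s)
  vertex-position s p k = ≡.trans
    (≡.cong (λ x → normalWord (+ toℕ (proj₁ x) , proj₂ x)) (Fin.remQuot-combine r s))
    (≡.cong (λ i → normalWord (+ i , s))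
      (≡.trans (Fin.toℕ-cast (ℕ.*-comm n 2) (combine k p)) (Fin.toℕ-combine k p)))
    where r = cast (ℕ.*-comm n 2) (combine k p)

  -- Separates the even part, so that modulo 2 only p - p′ remains.
  exponent-difference : ∀ p p′ k k′ →
    exponent p k ℤ.- exponent p′ k′ ≡ (+ toℕ k ℤ.- + toℕ k′) ℤ.* + 2 ℤ.+ (+ toℕ p ℤ.- + toℕ p′)
  exponent-difference p p′ k k′ = ≡.trans
    (≡.cong₂ ℤ._-_ (pos p k) (pos p′ k′))
    (eq (+ toℕ k) (+ toℕ k′) (+ toℕ p) (+ toℕ p′))
    where
    pos : ∀ p k → exponent p k ≡ + 2 ℤ.* + toℕ k ℤ.+ + toℕ p
    pos p k = ≡.cong (ℤ._+ + toℕ p) (ℤ.pos-* 2 (toℕ k))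
    eq : ∀ x x′ y y′ → (+ 2 ℤ.* x ℤ.+ y) ℤ.- (+ 2 ℤ.* x′ ℤ.+ y′) ≡ (x ℤ.- x′) ℤ.* + 2 ℤ.+ (y ℤ.- y′)
    eq = solve-∀

  vertex-position-b : ∀ s p k → proj₂ (coordinates (vertex (position s p k))) ≡ s
  vertex-position-b s p k = ≡.cong proj₂
    (≡.trans (≡.cong coordinates (vertex-position s p k)) (coordinates-normalWord (exponent p k , s)))

  ~-differentCoset : ∀ {s s′} p p′ k k′ → s ≢ s′ → vertex (position s p k) ~ vertex (position s′ p′ k′)
  ~-differentCoset {s} {s′} p p′ k k′ s≢s′ = ≢⇒//∈S (vertex (position s p k)) (vertex (position s′ p′ k′))
    λ eq → s≢s′ (≡.trans (≡.sym (vertex-position-b s p k)) (≡.trans eq (vertex-position-b s′ p′ k′)))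

  ~-sameCell : ∀ s p {k k′} → k ≢ k′ → vertex (position s p k) ~ vertex (position s p k′)
  ~-sameCell s p {k} {k′} k≢k′ = ≡.subst₂ _~_ (≡.sym (vertex-position s p k)) (≡.sym (vertex-position s p k′))
    (∣⇒normalWord-//∈S (exponent p k) (exponent p k′) s
      (divides (+ toℕ k ℤ.- + toℕ k′) (≡.trans (exponent-difference p p k k′)
        (≡.trans (≡.cong (λ d → (+ toℕ k ℤ.- + toℕ k′) ℤ.* + 2 ℤ.+ d) (ℤ.+-inverseʳ (+ toℕ p))) (ℤ.+-identityʳ _))))
      -- The quotient must also differ from ε, since ⟨a²⟩ enters S without it: different k give
      -- different positions, and the enumeration is injective.
      λ eq → k≢k′ (≡.cong (proj₂ ∘ proj₂) (≡.trans (≡.sym (split-position s p k))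
        (≡.trans (≡.cong split (same (≡.subst₂ _≈_ (≡.sym (vertex-position s p k)) (≡.sym (vertex-position s p k′)) eq)))
          (split-position s p k′)))))
    where
    same : ∀ {i j} → vertex i ≈ vertex j → i ≡ j
    same {i} {j} eq = ≡.trans (≡.sym (toFin-fromFin i)) (≡.trans (toFin-cong eq) (toFin-fromFin j))

  ≁-oppositeCell : ∀ s {p p′} k k′ → p ≢ p′ → ¬ vertex (position s p k) ~ vertex (position s p′ k′)
  ≁-oppositeCell s {p} {p′} k k′ p≢p′ adjacent = p≢p′ (2∣⇒≡ p p′
    (ℤ.∣m+n∣m⇒∣n (≡.subst (+ 2 ℤ.∣_) (exponent-difference p p′ k k′) 2∣) (divides (+ toℕ k ℤ.- + toℕ k′) ≡.refl)))
    where
    2∣ : + 2 ℤ.∣ exponent p k ℤ.- exponent p′ k′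
    2∣ = a^∈S⇒∣ _ (S-resp-≈ (normalWord-// (exponent p k) (exponent p′ k′) s)
      (≡.subst₂ _~_ (vertex-position s p k) (vertex-position s p′ k′) adjacent))
    2∣⇒≡ : ∀ (p p′ : Fin 2) → + 2 ℤ.∣ + toℕ p ℤ.- + toℕ p′ → p ≡ p′
    2∣⇒≡ 0F 0F _  = ≡.refl
    2∣⇒≡ 0F 1F 2∣ = contradiction (ℤ.∣⇒∣ᵤ 2∣) (ℕ.>⇒∤ ℕ.≤-refl)
    2∣⇒≡ 1F 0F 2∣ = contradiction (ℤ.∣⇒∣ᵤ 2∣) (ℕ.>⇒∤ ℕ.≤-refl)
    2∣⇒≡ 1F 1F _  = ≡.refl

  module _ {c ℓ₁ ℓ₂} (K : HeytingField c ℓ₁ ℓ₂) where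
    private module F = Field K
    open F using
      ( iverson; iverson-true; iverson-false; δ; δ-diagonal; δ-offDiagonal
      ; _+_; _*_; 1#; +-cong; +-congˡ; *-cong; *-congˡ; *-congʳ; *-identityˡ; zeroˡ; zeroʳ
      ; solve; _:+_; con; _:=_ )

    -- The matrix identity A + I + P = J, entry by entry. It is kept free of subtraction, so that it
    -- can be summed and handled by a solver for commutative semirings.
    adjacency-entry : ∀ s p k s′ p′ k′ →
      adjacencyMatrix K (Cay (T₈ₙ.finiteGroup n) (T₈ₙ.connectionSet n)) (position s p k) (position s′ p′ k′)
        + δ s s′ * (δ p p′ * δ k k′) + δ s s′ * δ (opposite p) p′ F.≈ 1#
    adjacency-entry s p k s′ p′ k′ = entry (s Fin.≟ s′) (p Fin.≟ p′) (k Fin.≟ k′)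
      where
      x = vertex (position s p k)
      y = vertex (position s′ p′ k′)

      -- `δ s s` does not compute for a variable s, so the values of the deltas are passed in as
      -- equations.
      combined : ∀ {u v w u′ v′ w′} → iverson (x ~? y) ≡ u → δ s s′ F.≈ v → δ p p′ * δ k k′ F.≈ w →
        v * w F.≈ u′ → v * δ (opposite p) p′ F.≈ v′ → u + u′ + v′ F.≈ w′ →
        iverson (x ~? y) + δ s s′ * (δ p p′ * δ k k′) + δ s s′ * δ (opposite p) p′ F.≈ w′
      combined ≡.refl δ≈v δδ≈w vw≈u′ vδ≈v′ eq = F.trans
        (+-cong (+-congˡ (F.trans (*-cong δ≈v δδ≈w) vw≈u′)) (F.trans (*-congʳ δ≈v) vδ≈v′)) eq

      entry : Dec (s ≡ s′) → Dec (p ≡ p′) → Dec (k ≡ k′) → _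
      entry (no s≢s′) _ _ = combined
        (iverson-true (x ~? y) (~-differentCoset p p′ k k′ s≢s′)) (δ-offDiagonal s≢s′) F.refl
        (zeroˡ _) (zeroˡ _) (solve 1 (λ u → u :+ con 0 :+ con 0 := u) F.refl 1#)
      entry (yes ≡.refl) (no p≢p′) _ = combined
        (iverson-false (x ~? y) (≁-oppositeCell s k k′ p≢p′)) (δ-diagonal {i = s} ≡.refl)
        (F.trans (*-congʳ (δ-offDiagonal p≢p′)) (zeroˡ _)) (zeroʳ _)
        (F.trans (*-identityˡ _) (δ-diagonal (≢⇒opposite p p′ p≢p′)))
        (solve 1 (λ u → con 0 :+ con 0 :+ u := u) F.refl 1#)
      entry (yes ≡.refl) (yes ≡.refl) (no k≢k′) = combined
        (iverson-true (x ~? y) (~-sameCell s p k≢k′)) (δ-diagonal {i = s} ≡.refl)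
        (F.trans (*-congˡ (δ-offDiagonal k≢k′)) (zeroʳ _)) (zeroʳ _)
        (F.trans (*-congˡ (δ-offDiagonal (opposite≢ p))) (zeroʳ _))
        (solve 1 (λ u → u :+ con 0 :+ con 0 := u) F.refl 1#)
      entry (yes ≡.refl) (yes ≡.refl) (yes ≡.refl) = combined
        (iverson-false (x ~? x) (~-irrefl ≈-refl)) (δ-diagonal {i = s} ≡.refl)
        (F.trans (*-cong (δ-diagonal {i = p} ≡.refl) (δ-diagonal {i = k} ≡.refl)) (*-identityˡ _)) (*-identityˡ _)
        (F.trans (*-congˡ (δ-offDiagonal (opposite≢ p))) (zeroʳ _))
        (solve 1 (λ u → con 0 :+ u :+ con 0 := u) F.refl 1#)

-- The matrix-vector product in block form.

module Blocks {c ℓ₁ ℓ₂} (K : HeytingField c ℓ₁ ℓ₂) (n : ℕ) where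
  open Field K
  open Cells n
  open ≈-Reasoning

  Blockwise : Set c
  Blockwise = Fin 4 → Fin 2 → Fin n → Carrier

  ∑³ : Blockwise → Carrier
  ∑³ f = sum (λ s → sum (λ p → sum (f s p)))

  ∑³-cong : ∀ f g → (∀ s p k → f s p k ≈ g s p k) → ∑³ f ≈ ∑³ g
  ∑³-cong f g f≈g = sum-cong-≋ {4} (λ s → sum-cong-≋ {2} (λ p → sum-cong-≋ (f≈g s p)))

  ∑³-+ : ∀ f g → ∑³ (λ s p k → f s p k + g s p k) ≈ ∑³ f + ∑³ g
  ∑³-+ f g = begin
    sum (λ s → sum (λ p → sum (λ k → f s p k + g s p k)))
      ≈⟨ sum-cong-≋ {4} (λ s → sum-cong-≋ {2} (λ p → ∑-distrib-+ (f s p) (g s p))) ⟩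
    sum (λ s → sum (λ p → sum (f s p) + sum (g s p)))
      ≈⟨ sum-cong-≋ {4} (λ s → ∑-distrib-+ (λ p → sum (f s p)) (λ p → sum (g s p))) ⟩
    sum (λ s → sum (λ p → sum (f s p)) + sum (λ p → sum (g s p)))
      ≈⟨ ∑-distrib-+ (λ s → sum (λ p → sum (f s p))) (λ s → sum (λ p → sum (g s p))) ⟩
    ∑³ f + ∑³ g ∎

  ∑²-δ : ∀ s p (g : Fin 4 → Fin 2 → Carrier) → sum (λ s′ → sum (λ p′ → δ s s′ * (δ p p′ * g s′ p′))) ≈ g s p
  ∑²-δ s p g = trans
    (sum-cong-≋ {4} (λ s′ → trans (sym (*-distribˡ-sum (δ s s′) (λ p′ → δ p p′ * g s′ p′))) (*-congˡ (sum-δ p (g s′)))))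
    (sum-δ s (λ s′ → g s′ p))

  blockwise : Vector Carrier (2 ℕ.* n ℕ.* 4) → Blockwise
  blockwise v s p k = v (position s p k)

  fromBlockwise : Blockwise → Vector Carrier (2 ℕ.* n ℕ.* 4)
  fromBlockwise f i = let s , p , k = split i in f s p k

  blockwise-fromBlockwise : ∀ f s p k → blockwise (fromBlockwise f) s p k ≡ f s p k
  blockwise-fromBlockwise f s p k = ≡.cong (λ (s , p , k) → f s p k) (split-position s p k)

  module _ (A : Matrix K {2 ℕ.* n ℕ.* 4})
    (entry : ∀ s p k s′ p′ k′ →
      A (position s p k) (position s′ p′ k′)
        + δ s s′ * (δ p p′ * δ k k′) + δ s s′ * δ (opposite p) p′ ≈ 1#)
    where

    -- This is A + I + P = J applied to v: I returns the coordinate, P the sum over the opposite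
    -- cell, J the total.
    ·-blockwise : ∀ v s p k →
      (_·_ K A v) (position s p k) + blockwise v s p k + sum (blockwise v s (opposite p)) ≈ ∑³ (blockwise v)
    ·-blockwise v s p k = begin
      (_·_ K A v) (position s p k) + x s p k + sum (x s (opposite p))
        ≈⟨ +-cong (+-cong (sum-position K (λ j → A (position s p k) j * v j)) (sym δδδ)) (sym δδ) ⟩
      ∑³ αx + ∑³ βx + ∑³ γx
        ≈⟨ +-congʳ (∑³-+ αx βx) ⟨
      ∑³ (λ s′ p′ k′ → αx s′ p′ k′ + βx s′ p′ k′) + ∑³ γx
        ≈⟨ ∑³-+ (λ s′ p′ k′ → αx s′ p′ k′ + βx s′ p′ k′) γx ⟨
      ∑³ (λ s′ p′ k′ → αx s′ p′ k′ + βx s′ p′ k′ + γx s′ p′ k′)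
        ≈⟨ ∑³-cong _ x (λ s′ p′ k′ → trans (collect _ _ _ _)
             (trans (*-congʳ (entry s p k s′ p′ k′)) (*-identityˡ _))) ⟩
      ∑³ x ∎
      where
      x αx βx γx : Blockwise
      x = blockwise v
      αx s′ p′ k′ = A (position s p k) (position s′ p′ k′) * x s′ p′ k′
      βx s′ p′ k′ = δ s s′ * (δ p p′ * δ k k′) * x s′ p′ k′
      γx s′ p′ k′ = δ s s′ * δ (opposite p) p′ * x s′ p′ k′

      collect : ∀ a b c y → a * y + b * y + c * y ≈ (a + b + c) * y
      collect = solve 4 (λ a b c y → a :* y :+ b :* y :+ c :* y := (a :+ b :+ c) :* y) refl

      δδδ : ∑³ βx ≈ x s p k
      δδδ = trans
        (sum-cong-≋ {4} (λ s′ → sum-cong-≋ {2} (λ p′ → begin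
          sum (λ k′ → δ s s′ * (δ p p′ * δ k k′) * x s′ p′ k′)
            ≈⟨ sum-cong-≋ (λ k′ → regroup (δ s s′) (δ p p′) (δ k k′) (x s′ p′ k′)) ⟩
          sum (λ k′ → δ s s′ * δ p p′ * (δ k k′ * x s′ p′ k′))
            ≈⟨ *-distribˡ-sum (δ s s′ * δ p p′) (λ k′ → δ k k′ * x s′ p′ k′) ⟨
          δ s s′ * δ p p′ * sum (λ k′ → δ k k′ * x s′ p′ k′)
            ≈⟨ *-congˡ (sum-δ k (x s′ p′)) ⟩
          δ s s′ * δ p p′ * x s′ p′ k
            ≈⟨ *-assoc _ _ _ ⟩
          δ s s′ * (δ p p′ * x s′ p′ k) ∎)))
        (∑²-δ s p (λ s′ p′ → x s′ p′ k))
        where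
        regroup : ∀ a b c y → a * (b * c) * y ≈ a * b * (c * y)
        regroup = solve 4 (λ a b c y → a :* (b :* c) :* y := a :* b :* (c :* y)) refl

      δδ : ∑³ γx ≈ sum (x s (opposite p))
      δδ = trans
        (sum-cong-≋ {4} (λ s′ → sum-cong-≋ {2} (λ p′ → trans
          (sym (*-distribˡ-sum (δ s s′ * δ (opposite p) p′) (x s′ p′))) (*-assoc _ _ _))))
        (∑²-δ s (opposite p) (λ s′ p′ → sum (x s′ p′)))

-- Consequences of the eigenvector equation.

module EigenEquation {c ℓ₁ ℓ₂} (K : HeytingField c ℓ₁ ℓ₂) (m : ℕ) where
  n = suc m
  open Field K
  open Blocks K n
  open ≈-Reasoning

  N 7N : Carrier
  N  = n ×ᶠ 1#
  7N = (7 ℕ.* n) ×ᶠ 1#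

  sum-const : ∀ y → sum {n} (λ _ → y) ≈ N * y
  sum-const y = begin
    sum {n} (λ _ → y)     ≈⟨ sum-replicate n ⟩
    n ×ᶠ y                ≈⟨ ×-congʳ n (*-identityˡ y) ⟨
    n ×ᶠ (1# * y)         ≈⟨ ×-assoc-* n 1# y ⟨
    N * y                 ∎

  EigenEquation : Carrier → Blockwise → Set ℓ₁
  EigenEquation μ x = ∀ s p k → μ * x s p k + sum (x s (opposite p)) ≈ ∑³ x

  module Solution {μ} {x : Blockwise} (eq : EigenEquation μ x) where

    T : Fin 4 → Fin 2 → Carrier
    T s p = sum (x s p)

    U : Fin 4 → Carrier
    U s = T s 0F + T s 1F

    σ : Carrier
    σ = ∑³ x

    T-equation : ∀ s p → μ * T s p + N * T s (opposite p) ≈ N * σ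
    T-equation s p = begin
      μ * T s p + N * T s (opposite p)
        ≈⟨ +-cong (*-distribˡ-sum μ (x s p)) (sym (sum-const (T s (opposite p)))) ⟩
      sum (λ k → μ * x s p k) + sum {n} (λ _ → T s (opposite p))
        ≈⟨ ∑-distrib-+ (λ k → μ * x s p k) (λ _ → T s (opposite p)) ⟨
      sum (λ k → μ * x s p k + T s (opposite p))
        ≈⟨ sum-cong-≋ (eq s p) ⟩
      sum {n} (λ _ → σ)
        ≈⟨ sum-const σ ⟩
      N * σ ∎

    U-equation : ∀ s → μ * U s + N * U s ≈ N * σ + N * σ
    U-equation s = begin
      μ * U s + N * U s
        ≈⟨ solve 4 (λ μ N t₀ t₁ →
             μ :* (t₀ :+ t₁) :+ N :* (t₀ :+ t₁) := (μ :* t₀ :+ N :* t₁) :+ (μ :* t₁ :+ N :* t₀))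
             refl μ N (T s 0F) (T s 1F) ⟩
      (μ * T s 0F + N * T s 1F) + (μ * T s 1F + N * T s 0F)
        ≈⟨ +-cong (T-equation s 0F) (T-equation s 1F) ⟩
      N * σ + N * σ ∎

    σ≈ΣU : σ ≈ U 0F + (U 1F + (U 2F + U 3F))
    σ≈ΣU = +-cong (drop0 0F) (+-cong (drop0 1F) (+-cong (drop0 2F) (trans (+-identityʳ _) (drop0 3F))))
      where
      drop0 : ∀ s → T s 0F + (T s 1F + 0#) ≈ U s
      drop0 s = +-congˡ (+-identityʳ _)

    σ-equation : μ * σ ≈ 7N * σ
    -- Over the four cosets the equations for U add up to (μ + N) σ = 8 N σ; cancelling one N σ
    -- leaves the factor 7.
    σ-equation = +-cancelʳ (N * σ) _ _ (begin
      μ * σ + N * σ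
        ≈⟨ +-cong (*-congˡ σ≈ΣU) (*-congˡ σ≈ΣU) ⟩
      μ * (U 0F + (U 1F + (U 2F + U 3F))) + N * (U 0F + (U 1F + (U 2F + U 3F)))
        ≈⟨ solve 6 (λ μ N u₀ u₁ u₂ u₃ →
             μ :* (u₀ :+ (u₁ :+ (u₂ :+ u₃))) :+ N :* (u₀ :+ (u₁ :+ (u₂ :+ u₃)))
             := (μ :* u₀ :+ N :* u₀) :+ ((μ :* u₁ :+ N :* u₁) :+ ((μ :* u₂ :+ N :* u₂) :+ (μ :* u₃ :+ N :* u₃))))
             refl μ N (U 0F) (U 1F) (U 2F) (U 3F) ⟩
      (μ * U 0F + N * U 0F) + ((μ * U 1F + N * U 1F) + ((μ * U 2F + N * U 2F) + (μ * U 3F + N * U 3F)))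
        ≈⟨ +-cong (U-equation 0F) (+-cong (U-equation 1F) (+-cong (U-equation 2F) (U-equation 3F))) ⟩
      (y + y) + ((y + y) + ((y + y) + (y + y)))
        -- The nested sum ending in `con 0` is the unfolding of `7 ×ᶠ N`.
        ≈⟨ solve 2 (λ N σ → let y = N :* σ in
             (y :+ y) :+ ((y :+ y) :+ ((y :+ y) :+ (y :+ y)))
             := (N :+ (N :+ (N :+ (N :+ (N :+ (N :+ (N :+ con 0))))))) :* σ :+ y) refl N σ ⟩
      7 ×ᶠ N * σ + N * σ
        ≈⟨ +-congʳ (*-congʳ (×-assocˡ 1# 7 n)) ⟩
      7N * σ + N * σ ∎)
      where y = N * σ

    σ≈0 : μ # 7N → σ ≈ 0#
    σ≈0 μ#7N = *-cancel-# μ#7N σ-equation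

    module _ (σ≈0 : σ ≈ 0#) where

      Nσ≈0 : N * σ ≈ 0#
      Nσ≈0 = trans (*-congˡ σ≈0) (zeroʳ N)

      U≈0 : μ # - N → ∀ s → U s ≈ 0#
      U≈0 μ#-N s = *-cancel-# μ#-N (begin
        μ * U s       ≈⟨ -‿uniqueˡ _ _ (trans (U-equation s) (trans (+-cong Nσ≈0 Nσ≈0) (+-identityˡ 0#))) ⟩
        - (N * U s)   ≈⟨ -‿distribˡ-* N (U s) ⟩
        - N * U s     ∎)

      T≈0 : μ # N → ∀ s → U s ≈ 0# → ∀ p → T s p ≈ 0#
      T≈0 μ#N s U≈0 p = *-cancel-# μ#N (begin
        μ * T s p                                              ≈⟨ +-identityʳ _ ⟨
        -- The zero added is N times the coset sum; it turns the opposite cell's term into one for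
        -- the same cell.
        μ * T s p + 0#                                         ≈⟨ +-congˡ (trans (*-congˡ (trans (both p) U≈0)) (zeroʳ N)) ⟨
        μ * T s p + N * (T s (opposite p) + T s p)             ≈⟨ +-congˡ (distribˡ N _ _) ⟩
        μ * T s p + (N * T s (opposite p) + N * T s p)         ≈⟨ +-assoc _ _ _ ⟨
        μ * T s p + N * T s (opposite p) + N * T s p           ≈⟨ +-congʳ (trans (T-equation s p) Nσ≈0) ⟩
        0# + N * T s p                                         ≈⟨ +-identityˡ _ ⟩
        N * T s p                                              ∎)
        where
        both : ∀ p → T s (opposite p) + T s p ≈ U s
        both 0F = +-comm _ _
        both 1F = refl

      -- A vanishing corner reduces the equation there to T(s , 1) = σ = 0, and then the summed
      -- equation for the cell (s , 1) leaves N T(s , 0) = 0. Nothing is asked of μ, so this serves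
      -- μ = -N and μ = N, where `U≈0` or `T≈0` is out of reach, and makes corners the pivots.
      corner≈0⇒T≈0 : N # 0# → ∀ s → x s 0F 0F ≈ 0# → ∀ p → T s p ≈ 0#
      corner≈0⇒T≈0 N#0 s x≈0 = λ { 0F → T₀≈0 ; 1F → T₁≈0 }
        where
        T₁≈0 : T s 1F ≈ 0#
        T₁≈0 = begin
          T s 1F                     ≈⟨ +-identityˡ _ ⟨
          0# + T s 1F                ≈⟨ +-congʳ (trans (*-congˡ x≈0) (zeroʳ μ)) ⟨
          μ * x s 0F 0F + T s 1F     ≈⟨ eq s 0F 0F ⟩
          σ                          ≈⟨ σ≈0 ⟩
          0#                         ∎
        T₀≈0 : T s 0F ≈ 0#
        T₀≈0 = *-cancel-0 N#0 (begin
          N * T s 0F                 ≈⟨ +-identityˡ _ ⟨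
          0# + N * T s 0F            ≈⟨ +-congʳ (trans (*-congˡ T₁≈0) (zeroʳ μ)) ⟨
          μ * T s 1F + N * T s 0F    ≈⟨ T-equation s 1F ⟩
          N * σ                      ≈⟨ Nσ≈0 ⟩
          0#                         ∎)

      T≈0⇒x≈0 : μ # 0# → (∀ s p → T s p ≈ 0#) → ∀ s p k → x s p k ≈ 0#
      T≈0⇒x≈0 μ#0 T≈0 s p k = *-cancel-0 μ#0 (begin
        μ * x s p k                          ≈⟨ +-identityʳ _ ⟨
        μ * x s p k + 0#                     ≈⟨ +-congˡ (T≈0 s (opposite p)) ⟨
        μ * x s p k + T s (opposite p)       ≈⟨ eq s p k ⟩
        σ                                    ≈⟨ σ≈0 ⟩
        0#                                   ∎)

      σ≈0⇒x≈0 : μ # - N → μ # N → μ # 0# → ∀ s p k → x s p k ≈ 0#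
      σ≈0⇒x≈0 μ#-N μ#N μ#0 = T≈0⇒x≈0 μ#0 (λ s → T≈0 μ#N s (U≈0 μ#-N s))

    -- Replaces `σ≈0` when μ = 7N. The corner equation gives T(0 , 1) = σ; the summed equation for
    -- (0 , 0) then forces T(0 , 0) = 0, and the one for (0 , 1) becomes μ σ = N σ. So a single
    -- corner determines an eigenvector.
    corner≈0⇒σ≈0 : μ # N → μ # 0# → x 0F 0F 0F ≈ 0# → σ ≈ 0#
    corner≈0⇒σ≈0 μ#N μ#0 x≈0 = *-cancel-# μ#N (begin
      μ * σ                        ≈⟨ *-congˡ T₁≈σ ⟨
      μ * T 0F 1F                  ≈⟨ +-identityʳ _ ⟨
      μ * T 0F 1F + 0#             ≈⟨ +-congˡ (trans (*-congˡ T₀≈0) (zeroʳ N)) ⟨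
      μ * T 0F 1F + N * T 0F 0F    ≈⟨ T-equation 0F 1F ⟩
      N * σ                        ∎)
      where
      T₁≈σ : T 0F 1F ≈ σ
      T₁≈σ = trans (sym (+-identityˡ _))
        (trans (+-congʳ (sym (trans (*-congˡ x≈0) (zeroʳ μ)))) (eq 0F 0F 0F))
      T₀≈0 : T 0F 0F ≈ 0#
      T₀≈0 = *-cancel-0 μ#0 (+-cancelʳ (N * σ) _ _ (begin
        μ * T 0F 0F + N * σ          ≈⟨ +-congˡ (*-congˡ T₁≈σ) ⟨
        μ * T 0F 0F + N * T 0F 1F    ≈⟨ T-equation 0F 0F ⟩
        N * σ                        ≈⟨ +-identityˡ _ ⟨
        0# + N * σ                   ∎))

-- Bases of the four eigenspaces.

module Spectrum {c ℓ₁ ℓ₂} (K : HeytingField c ℓ₁ ℓ₂) (char : CharacteristicZero K) (m : ℕ) .{{n≢0 : NonZero (suc m)}} where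
  open EigenEquation K m
  open Field K
  open Blocks K n
  open Cells n
  open ≈-Reasoning
  open Adjacency (suc m) {{n≢0}} using (adjacency-entry)

  A : Matrix K {2 ℕ.* n ℕ.* 4}
  A = adjacencyMatrix K (Cay (T₈ₙ.finiteGroup (suc m) {{n≢0}}) (T₈ₙ.connectionSet (suc m) {{n≢0}}))

  module _ {θ μ : Carrier} (θ+1≈μ : θ + 1# ≈ μ) where

    shift : ∀ x t → μ * x + t ≈ θ * x + x + t
    shift x t = +-congʳ (begin
      μ * x             ≈⟨ *-congʳ θ+1≈μ ⟨
      (θ + 1#) * x      ≈⟨ distribʳ x θ 1# ⟩
      θ * x + 1# * x    ≈⟨ +-congˡ (*-identityˡ x) ⟩
      θ * x + x         ∎)

    eigenspace⇒equation : ∀ {v} → v ∈ Eigenspace K A θ → EigenEquation μ (blockwise v)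
    eigenspace⇒equation {v} v∈ s p k = begin
      μ * blockwise v s p k + sum (blockwise v s (opposite p))                                ≈⟨ shift _ _ ⟩
      θ * blockwise v s p k + blockwise v s p k + sum (blockwise v s (opposite p))            ≈⟨ +-congʳ (+-congʳ (v∈ (position s p k))) ⟨
      _·_ K A v (position s p k) + blockwise v s p k + sum (blockwise v s (opposite p))       ≈⟨ ·-blockwise A (adjacency-entry K) v s p k ⟩
      ∑³ (blockwise v)                                                                        ∎

    equation⇒eigenspace : ∀ {v} → EigenEquation μ (blockwise v) → v ∈ Eigenspace K A θ
    equation⇒eigenspace {v} eq = position-elim (λ i → _·_ K A v i ≈ θ * v i) λ s p k →
      +-cancelʳ (blockwise v s p k) _ _ (+-cancelʳ (sum (blockwise v s (opposite p))) _ _ (begin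
        _·_ K A v (position s p k) + blockwise v s p k + sum (blockwise v s (opposite p))     ≈⟨ ·-blockwise A (adjacency-entry K) v s p k ⟩
        ∑³ (blockwise v)                                                                      ≈⟨ eq s p k ⟨
        μ * blockwise v s p k + sum (blockwise v s (opposite p))                              ≈⟨ shift _ _ ⟩
        θ * blockwise v s p k + blockwise v s p k + sum (blockwise v s (opposite p))          ∎))

    blockwise⇒eigenspace : ∀ {f} → EigenEquation μ f → fromBlockwise f ∈ Eigenspace K A θ
    blockwise⇒eigenspace {f} eq = equation⇒eigenspace λ s p k → begin
      μ * x s p k + sum (x s (opposite p))      ≈⟨ +-cong (*-congˡ (x≈f s p k)) (sum-cong-≋ (x≈f s (opposite p))) ⟩
      μ * f s p k + sum (f s (opposite p))      ≈⟨ eq s p k ⟩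
      ∑³ f                                      ≈⟨ ∑³-cong x f x≈f ⟨
      ∑³ x                                      ∎
      where
      x : Blockwise
      x = blockwise (fromBlockwise f)
      x≈f : ∀ s p k → x s p k ≈ f s p k
      x≈f s p k = reflexive (blockwise-fromBlockwise f s p k)

    blockwise⇒dimension : ∀ {d} (f : Fin d → Blockwise) (s : Fin d → Fin 4) (p : Fin d → Fin 2) (k : Fin d → Fin n) →
      (∀ j → EigenEquation μ (f j)) →
      (∀ i j → f j (s i) (p i) (k i) ≈ δ j i) →
      (∀ {x} → EigenEquation μ x → (∀ j → x (s j) (p j) (k j) ≈ 0#) → ∀ s p k → x s p k ≈ 0#) →
      HasDimension K (Eigenspace K A θ) d
    blockwise⇒dimension f s p k eq f-pivot determined = pivots⇒dimension A θ
      (fromBlockwise ∘ f) (λ j → position (s j) (p j) (k j))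
      (λ j → blockwise⇒eigenspace (eq j))
      (λ i j → trans (reflexive (blockwise-fromBlockwise (f j) (s i) (p i) (k i))) (f-pivot i j))
      (λ w∈ w≈0 → position-elim _ (determined (eigenspace⇒equation w∈) w≈0))

  -- On vectors constant on cells the equation becomes eight scalar ones. The bases for μ = 7N, -N
  -- and N are all of this kind.
  cellwise-equation : ∀ {μ} (g : Fin 4 → Fin 2 → Carrier) →
    (∀ s p → μ * g s p + N * g s (opposite p) ≈ sum (λ s → sum (λ p → N * g s p))) →
    EigenEquation μ (λ s p k → g s p)
  cellwise-equation {μ} g eq s p k = begin
    μ * g s p + sum {n} (λ _ → g s (opposite p))      ≈⟨ +-congˡ (sum-const _) ⟩
    μ * g s p + N * g s (opposite p)                  ≈⟨ eq s p ⟩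
    sum (λ s → sum (λ p → N * g s p))                 ≈⟨ sum-cong-≋ {4} (λ s → sum-cong-≋ {2} (λ p → sum-const (g s p))) ⟨
    ∑³ (λ s p k → g s p)                              ∎

  N#0 : N # 0#
  N#0 = char n

  -N : Carrier
  -N = - N

  -- The all-ones vector, as for any regular graph: each side counts N for each of the eight cells.
  dimension-7N : ∀ {θ} → θ + 1# ≈ 7N → 7N # -N → 7N # N → 7N # 0# → HasDimension K (Eigenspace K A θ) 1
  dimension-7N θ+1≈7N 7N#-N 7N#N 7N#0 = blockwise⇒dimension θ+1≈7N
    (λ _ _ _ _ → 1#) (λ _ → 0F) (λ _ → 0F) (λ _ → 0F)
    (λ _ → cellwise-equation {7N} (λ _ _ → 1#) λ _ _ → trans
      (+-congʳ (*-congʳ (sym (×-assocˡ 1# 7 n))))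
      (solve 2 (λ N u → (N :+ (N :+ (N :+ (N :+ (N :+ (N :+ (N :+ con 0))))))) :* u :+ N :* u
        := let t = N :* u :+ (N :* u :+ con 0) in t :+ (t :+ (t :+ (t :+ con 0)))) refl N 1#))
    (λ { 0F 0F → refl ; 0F (suc ()) ; (suc ()) _ })
    (λ eq x≈0 → let open Solution eq in
      σ≈0⇒x≈0 (corner≈0⇒σ≈0 7N#N 7N#0 (x≈0 0F)) 7N#-N 7N#N 7N#0)

  -- The basis consists of the indicator of coset j + 1 minus that of coset 0, with the corners of
  -- cosets 1, 2, 3 as pivots.
  dimension-‿N : ∀ {θ} → θ + 1# ≈ -N → -N # 7N → -N # N → -N # 0# → HasDimension K (Eigenspace K A θ) 3
  dimension-‿N θ+1≈-N -N#7N -N#N -N#0 = blockwise⇒dimension θ+1≈-N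
    (λ j s _ _ → h j s) suc (λ _ → 0F) (λ _ → 0F)
    (λ j → cellwise-equation { -N} (λ s _ → h j s) λ s _ → trans
      (trans (sym (distribʳ (h j s) -N N)) (trans (*-congʳ (-‿inverseˡ N)) (zeroˡ _)))
      (sym (Σh≈0 j)))
    -- At a pivot s = `suc i` the delta at 0 computes to 0 and `δ (suc j) (suc i)` to `δ j i`.
    (λ i j → x-0≈x _)
    (λ {x} eq x≈0 → let
      open Solution eq
      σ≈0′ = σ≈0 -N#7N
      T-suc≈0 : ∀ j p → T (suc j) p ≈ 0#
      T-suc≈0 j = corner≈0⇒T≈0 σ≈0′ N#0 (suc j) (x≈0 j)
      U-suc≈0 : ∀ j → U (suc j) ≈ 0#
      U-suc≈0 j = trans (+-cong (T-suc≈0 j 0F) (T-suc≈0 j 1F)) (+-identityˡ 0#)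
      -- Coset 0 has no pivot, and `U≈0` fails for μ = -N; its sum is recovered from the vanishing
      -- total.
      U₀≈0 : U 0F ≈ 0#
      U₀≈0 = begin
        U 0F                               ≈⟨ solve 1 (λ u → u :+ (con 0 :+ (con 0 :+ con 0)) := u) refl (U 0F) ⟨
        U 0F + (0# + (0# + 0#))            ≈⟨ +-congˡ (+-cong (U-suc≈0 0F) (+-cong (U-suc≈0 1F) (U-suc≈0 2F))) ⟨
        U 0F + (U 1F + (U 2F + U 3F))      ≈⟨ σ≈ΣU ⟨
        σ                                  ≈⟨ σ≈0′ ⟩
        0#                                 ∎
      in T≈0⇒x≈0 σ≈0′ -N#0 λ { 0F → T≈0 σ≈0′ -N#N 0F U₀≈0 ; (suc j) → T-suc≈0 j })
    where
    h : Fin 3 → Fin 4 → Carrier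
    h j s = δ (suc j) s - δ 0F s
    Σh≈0 : ∀ j → sum (λ s → sum {2} (λ _ → N * h j s)) ≈ 0#
    Σh≈0 j = begin
      sum (λ s → sum {2} (λ _ → N * h j s))
        ≈⟨ sum-cong-≋ {4} (λ s → solve 2 (λ N h → N :* h :+ (N :* h :+ con 0) := (N :+ N) :* h) refl N (h j s)) ⟩
      sum (λ s → (N + N) * h j s)              ≈⟨ *-distribˡ-sum (N + N) (h j) ⟨
      (N + N) * sum (h j)                      ≈⟨ *-congˡ (sum-δ-δ (suc j) 0F) ⟩
      (N + N) * 0#                             ≈⟨ zeroʳ _ ⟩
      0#                                       ∎

  -- One basis vector per coset, equal to 1 on its cell p = 0 and to -1 on its cell p = 1, with the
  -- corners as pivots.
  dimension-N : ∀ {θ} → θ + 1# ≈ N → N # 7N → HasDimension K (Eigenspace K A θ) 4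
  dimension-N θ+1≈N N#7N = blockwise⇒dimension θ+1≈N
    (λ j s p _ → δ j s * sign p) (λ j → j) (λ _ → 0F) (λ _ → 0F)
    (λ j → cellwise-equation {N} (λ s p → δ j s * sign p) λ s p → trans (cancel j s p)
      (sym (sum-zero {4} (λ s → trans (+-congˡ (+-identityʳ _)) (cancel j s 0F)))))
    (λ i j → *-identityʳ _)
    (λ eq x≈0 → let open Solution eq; σ≈0′ = σ≈0 N#7N in
      T≈0⇒x≈0 σ≈0′ N#0 λ s → corner≈0⇒T≈0 σ≈0′ N#0 s (x≈0 s))
    where
    sign : Fin 2 → Carrier
    sign 0F = 1#
    sign 1F = - 1#
    sign-opposite : ∀ p → sign p + sign (opposite p) ≈ 0#
    sign-opposite 0F = -‿inverseʳ 1#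
    sign-opposite 1F = -‿inverseˡ 1#
    cancel : ∀ j s p → N * (δ j s * sign p) + N * (δ j s * sign (opposite p)) ≈ 0#
    cancel j s p = begin
      N * (δ j s * sign p) + N * (δ j s * sign (opposite p))
        ≈⟨ solve 4 (λ N d x y → N :* (d :* x) :+ N :* (d :* y) := N :* d :* (x :+ y)) refl N (δ j s) (sign p) (sign (opposite p)) ⟩
      N * δ j s * (sign p + sign (opposite p))   ≈⟨ *-congˡ (sign-opposite p) ⟩
      N * δ j s * 0#                             ≈⟨ zeroʳ _ ⟩
      0#                                         ∎

  -- In each of the eight cells the basis takes the unit vectors at k ≠ 0 minus the one at k = 0;
  -- the pivots are all positions with k ≠ 0. For m = 0 the basis is empty and the argument shows
  -- that -1 is not an eigenvalue.
  dimension-0 : ∀ {θ} → θ + 1# ≈ 0# → 0# # 7N → 0# # -N → 0# # N → HasDimension K (Eigenspace K A θ) (8 ℕ.* m)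
  dimension-0 θ+1≈0 0#7N 0#-N 0#N = blockwise⇒dimension θ+1≈0
    (λ j s p k → e j s p * (δ (suc (k° j)) k - δ 0F k)) s° p° (suc ∘ k°)
    (λ j s p k → begin
      0# * _ + sum (λ k → e j s (opposite p) * (δ (suc (k° j)) k - δ 0F k))   ≈⟨ +-cong (zeroˡ _) (cell-sum j s (opposite p)) ⟩
      0# + 0#                                                                 ≈⟨ +-identityˡ 0# ⟩
      0#                                                                      ≈⟨ sum-zero {4} (λ s → sum-zero {2} (cell-sum j s)) ⟨
      ∑³ (λ s p k → e j s p * (δ (suc (k° j)) k - δ 0F k))                    ∎)
    -- The deltas for s, p and k merge into one, because the triple of coordinates encodes the index
    -- j injectively.
    (λ i j → begin
      δ (s° j) (s° i) * δ (p° j) (p° i) * (δ (k° j) (k° i) - 0#)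
        ≈⟨ *-cong (sym (δ-combine (s° j) (s° i) (p° j) (p° i))) (x-0≈x _) ⟩
      δ (combine (s° j) (p° j)) (combine (s° i) (p° i)) * δ (k° j) (k° i)
        ≈⟨ δ-combine (combine (s° j) (p° j)) (combine (s° i) (p° i)) (k° j) (k° i) ⟨
      δ (join j) (join i)
        ≡⟨ ≡.cong₂ δ (join≡ j) (join≡ i) ⟩
      δ j i ∎)
    (λ {x} eq x≈0 → let
      open Solution eq
      σ≈0′ = σ≈0 0#7N
      x-suc≈0 : ∀ s p k → x s p (suc k) ≈ 0#
      x-suc≈0 s p k = ≡.subst (λ (s , p , k) → x s p (suc k) ≈ 0#) (split°-join s p k) (x≈0 (combine (combine s p) k))
      x-zero≈0 : ∀ s p → x s p 0F ≈ 0#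
      x-zero≈0 s p = begin
        -- The cell sum is zero, so the one coordinate without a pivot vanishes with the others.
        x s p 0F                                  ≈⟨ +-identityʳ _ ⟨
        x s p 0F + 0#                             ≈⟨ +-congˡ (sum-zero (x-suc≈0 s p)) ⟨
        T s p                                     ≈⟨ T≈0 σ≈0′ 0#N s (U≈0 σ≈0′ 0#-N s) p ⟩
        0#                                        ∎
      in λ { s p zero → x-zero≈0 s p ; s p (suc k) → x-suc≈0 s p k })
    where
    split° : Fin (8 ℕ.* m) → Fin 4 × Fin 2 × Fin m
    split° j = let r , k = remQuot {8} m j
                   s , p = remQuot {4} 2 r
               in s , p , k
    s° : Fin (8 ℕ.* m) → Fin 4
    s° = proj₁ ∘ split°
    p° : Fin (8 ℕ.* m) → Fin 2
    p° = proj₁ ∘ proj₂ ∘ split°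
    k° : Fin (8 ℕ.* m) → Fin m
    k° = proj₂ ∘ proj₂ ∘ split°
    join : Fin (8 ℕ.* m) → Fin (8 ℕ.* m)
    join j = combine (combine (s° j) (p° j)) (k° j)
    join≡ : ∀ j → join j ≡ j
    join≡ j = ≡.trans
      (≡.cong (λ r → combine r (k° j)) (Fin.combine-remQuot {4} 2 (proj₁ (remQuot {8} m j))))
      (Fin.combine-remQuot {8} m j)
    split°-join : ∀ s p k → split° (combine (combine s p) k) ≡ (s , p , k)
    split°-join s p k = ≡.trans
      (≡.cong (λ (r , k) → let s , p = remQuot {4} 2 r in s , p , k) (Fin.remQuot-combine (combine s p) k))
      (≡.cong (λ (s , p) → s , p , k) (Fin.remQuot-combine s p))
    e : Fin (8 ℕ.* m) → Fin 4 → Fin 2 → Carrier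
    e j s p = δ (s° j) s * δ (p° j) p
    cell-sum : ∀ j s p → sum (λ k → e j s p * (δ (suc (k° j)) k - δ 0F k)) ≈ 0#
    cell-sum j s p = begin
      sum (λ k → e j s p * (δ (suc (k° j)) k - δ 0F k))    ≈⟨ *-distribˡ-sum (e j s p) (λ k → δ (suc (k° j)) k - δ 0F k) ⟨
      e j s p * sum (λ k → δ (suc (k° j)) k - δ 0F k)      ≈⟨ *-congˡ (sum-δ-δ (suc (k° j)) 0F) ⟩
      e j s p * 0#                                         ≈⟨ zeroʳ _ ⟩
      0#                                                   ∎

  -- The spectrum and integrality.

  μ⁺ μ⁻ μ₁ μ₀ : ℤ
  μ⁺ = + 7 ℤ.* + n
  μ⁻ = ℤ.- + n
  μ₁ = + n
  μ₀ = + 0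

  spectrum : List (Carrier × ℕ)
  spectrum =
      [ ℤ→ (μ⁺ ℤ.- + 1) ]^ 1
    ∷ [ ℤ→ (μ⁻ ℤ.- + 1) ]^ 3
    ∷ [ ℤ→ (μ₁ ℤ.- + 1) ]^ 4
    ∷ [ ℤ→ (μ₀ ℤ.- + 1) ]^ (8 ℕ.* m)
    ∷ []

  μ⁺≢μ⁻ : μ⁺ ≢ μ⁻
  μ⁺≢μ⁻ ()
  μ⁺≢μ₁ : μ⁺ ≢ μ₁
  -- 7n unfolds to n plus a successor because n is itself a successor; the other inequalities are
  -- settled by constructors.
  μ⁺≢μ₁ = ℕ.m+1+n≢m n ∘ ℤ.+-injective
  μ⁺≢μ₀ : μ⁺ ≢ μ₀
  μ⁺≢μ₀ ()
  μ⁻≢μ₁ : μ⁻ ≢ μ₁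
  μ⁻≢μ₁ ()
  μ⁻≢μ₀ : μ⁻ ≢ μ₀
  μ⁻≢μ₀ ()
  μ₁≢μ₀ : μ₁ ≢ μ₀
  μ₁≢μ₀ ()

  distinct : AllPairs (λ x y → proj₁ x # proj₁ y) spectrum
  distinct =
      (pred μ⁺≢μ⁻ ∷ pred μ⁺≢μ₁ ∷ pred μ⁺≢μ₀ ∷ [])
    ∷ (pred μ⁻≢μ₁ ∷ pred μ⁻≢μ₀ ∷ [])
    ∷ (pred μ₁≢μ₀ ∷ [])
    ∷ []
    ∷ []
    where
    open AbelianGroupProperties ℤ.+-0-abelianGroup using (∙-cancelʳ)
    pred : ∀ {i j} → i ≢ j → ℤ→ (i ℤ.- + 1) # ℤ→ (j ℤ.- + 1)
    pred {i} {j} i≢j = ℤ→-injective-# char {i ℤ.- + 1} {j ℤ.- + 1} (i≢j ∘ ∙-cancelʳ -[1+ 0 ] i j)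

  θ+1 : ∀ μ → ℤ→ (μ ℤ.- + 1) + 1# ≈ ℤ→ μ
  θ+1 μ = begin
    ℤ→ (μ ℤ.- + 1) + 1#      ≈⟨ +-congʳ (ℤ→-pred μ) ⟩
    ℤ→ μ - 1# + 1#           ≈⟨ +-assoc _ _ _ ⟩
    ℤ→ μ + (- 1# + 1#)       ≈⟨ +-congˡ (-‿inverseˡ 1#) ⟩
    ℤ→ μ + 0#                ≈⟨ +-identityʳ _ ⟩
    ℤ→ μ                     ∎

  multiplicities : All (λ x → HasDimension K (Eigenspace K A (proj₁ x)) (proj₂ x)) spectrum
  multiplicities =
      dimension-7N (θ+1 μ⁺) (apart μ⁺≢μ⁻) (apart μ⁺≢μ₁) (apart μ⁺≢μ₀)
    ∷ dimension-‿N (θ+1 μ⁻) (#-sym (apart μ⁺≢μ⁻)) (apart μ⁻≢μ₁) (apart μ⁻≢μ₀)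
    ∷ dimension-N (θ+1 μ₁) (#-sym (apart μ⁺≢μ₁))
    ∷ dimension-0 (θ+1 μ₀) (#-sym (apart μ⁺≢μ₀)) (#-sym (apart μ⁻≢μ₀)) (#-sym (apart μ₁≢μ₀))
    ∷ []
    where
    apart : ∀ {i j} → i ≢ j → ℤ→ i # ℤ→ j
    apart = ℤ→-injective-# char

  exhaustive : ∀ θ → IsEigenvalue K A θ → Any (λ x → θ ≈ proj₁ x) spectrum
  exhaustive θ (v , v∈ , i , vᵢ#0) = any-≈ proj₁ θ distinct λ
    -- If θ were apart from all four values, the whole chain would apply and v would vanish, against
    -- the coordinate of v that is apart from 0.
    { (θ#₁ ∷ θ#₂ ∷ θ#₃ ∷ θ#₄ ∷ []) → proj₂ (tight _ _) (position-elim (λ i → v i ≈ 0#)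
        (σ≈0⇒x≈0 (σ≈0 (shift-# μ⁺ θ#₁)) (shift-# μ⁻ θ#₂) (shift-# μ₁ θ#₃) (shift-# μ₀ θ#₄)) i) vᵢ#0
    }
    where
    open Solution (eigenspace⇒equation {θ} refl {v} v∈)
    shift-# : ∀ μ → θ # ℤ→ (μ ℤ.- + 1) → θ + 1# # ℤ→ μ
    shift-# μ = #-resp-difference (begin
      θ - ℤ→ (μ ℤ.- + 1)                  ≈⟨ +-identityʳ _ ⟨
      θ - ℤ→ (μ ℤ.- + 1) + 0#             ≈⟨ +-congˡ (-‿inverseʳ 1#) ⟨
      θ - ℤ→ (μ ℤ.- + 1) + (1# - 1#)      ≈⟨ solve 4 (λ a b c d → a :+ b :+ (c :+ d) := a :+ c :+ (b :+ d)) refl θ _ 1# (- 1#) ⟩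
      θ + 1# + (- ℤ→ (μ ℤ.- + 1) - 1#)    ≈⟨ +-congˡ (-‿+-comm _ 1#) ⟩
      θ + 1# - (ℤ→ (μ ℤ.- + 1) + 1#)      ≈⟨ +-congˡ (-‿cong (θ+1 μ)) ⟩
      θ + 1# - ℤ→ μ                       ∎)

  integral : Integral K (Cay (T₈ₙ.finiteGroup (suc m) {{n≢0}}) (T₈ₙ.connectionSet (suc m) {{n≢0}}))
  integral θ eigenvalue with exhaustive θ eigenvalue
  ... | here θ≈                         = μ⁺ ℤ.- + 1 , θ≈
  ... | there (here θ≈)                 = μ⁻ ℤ.- + 1 , θ≈
  ... | there (there (here θ≈))         = μ₁ ℤ.- + 1 , θ≈
  ... | there (there (there (here θ≈))) = μ₀ ℤ.- + 1 , θ≈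

  hasSpectrum : HasSpectrum K (Cay (T₈ₙ.finiteGroup (suc m) {{n≢0}}) (T₈ₙ.connectionSet (suc m) {{n≢0}})) spectrum
  hasSpectrum = record
    { distinct       = distinct
    ; multiplicities = multiplicities
    ; exhaustive     = exhaustive
    ; total          = total m
    }
    where
    total : ∀ m → 1 ℕ.+ (3 ℕ.+ (4 ℕ.+ (8 ℕ.* m ℕ.+ 0))) ≡ 2 ℕ.* suc m ℕ.* 4
    total = ℕ-RingSolver.solve-∀

open import Data.Integer.Base using (+_; -_; _-_) renaming (_*_ to _*ᶻ_)
open import Data.Nat.Base using (_*_; _∸_)

corollary3p2 : ∀ {c ℓ₁ ℓ₂} (K : HeytingField c ℓ₁ ℓ₂) → CharacteristicZero K →
    (n : ℕ) .{{_ : NonZero n}} →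
    let Γ = Cay (T₈ₙ.finiteGroup n) (T₈ₙ.connectionSet n) in
    Connected Γ × Integral K Γ × HasSpectrum K Γ
    ( [ fromℤ K (+ 7 *ᶻ + n - + 1) ]^ 1
    ∷ [ fromℤ K (- (+ n) - + 1) ]^ 3
    ∷ [ fromℤ K (+ n - + 1) ]^ 4
    ∷ [ fromℤ K (- (+ 1)) ]^ (8 * (n ∸ 1))
    ∷ [] )
-- With n = `suc m` the listed values and multiplicities reduce to those of `spectrum`: `n ∸ 1` to m
-- and `μ₀ - 1` to -1.
corollary3p2 K char (suc m) {{n≢0}} = Adjacency.connected (suc m) {{n≢0}} , integral , hasSpectrum
  where open Spectrum K char m {{n≢0}}
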